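{- Let $k \geq 2$ be an integer. Then $\mathrm{cms}(H) \leq \frac{1}{k+1}|E(H)|$ for any graph $H$ that has $B_k$ as a subgraph. Furthermore, for all integers $n \geq 3k+5$ such that $nk$ is even, there is a $k$-regular graph on $n$ vertices with $B_k$ as a subgraph.
   Context: All graphs are finite and simple. For even $k$, $B_k$ is the complete graph $K_{k+1}$. For odd $k$, $B_k$ is the graph on $k+2$ vertices whose complement is the vertex-disjoint union of a path on $3$ vertices and a perfect matching on the remaining $k-1$ vertices. For a graph $G$ with $m$ edges, an ordering is a bijection $\ell:E(G)\to\mathbb{Z}_m$; $d_\ell(e,e')$ is the smallest positive $d$ with $\ell(e)+d=\ell(e')$ in $\mathbb{Z}_m$, $d_\ell\{e,e'\}=\min\{d_\ell(e,e'),d_\ell(e',e)\}$; $\mathrm{cms}(\ell)$ is the largest $s\in\{1,\dots,m\}$ with $d_\ell\{e,e'\}\geq s$ for all pairs of adjacent (vertex-sharing) edges, and $\mathrm{cms}(G)$ is the maximum of $\mathrm{cms}(\ell)$ over all orderings of $G$. -}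

module Defs where

open import Data.Nat using (ℕ; zero; suc; _+_; _*_; _∸_; _≤_; _<ᵇ_; _≡ᵇ_)
open import Data.Bool using (Bool; true; false; not; _∧_; _∨_; if_then_else_)
open import Data.Bool.Properties using (∨-comm)
open import Data.Fin using (Fin; toℕ)
open import Data.Fin.Base using () renaming (_<_ to _<ᶠ_)
open import Data.List using (List; length; filterᵇ; allFin)
open import Data.Product using (Σ; _×_; _,_)
open import Data.Sum using (_⊎_)
open import Function.Bundles using (_⤖_; Bijection)
open import Function.Definitions using (Injective)
open import Relation.Binary.PropositionalEquality using (_≡_; _≢_; refl; cong₂)

record Graph (n : ℕ) : Set where
  field
    adj    : Fin n → Fin n → Bool
    sym    : ∀ u v → adj u v ≡ adj v u
    irrefl : ∀ u → adj u u ≡ false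
open Graph public

-- An edge {u,v} is represented uniquely by its endpoints with u < v.
record Edge {n : ℕ} (G : Graph n) : Set where
  constructor edge
  field
    src   : Fin n
    tgt   : Fin n
    lt    : src <ᶠ tgt
    isAdj : adj G src tgt ≡ true
open Edge public

ShareVertex : ∀ {n} {G : Graph n} → Edge G → Edge G → Set
ShareVertex e e' = (src e ≡ src e') ⊎ (src e ≡ tgt e') ⊎ (tgt e ≡ src e') ⊎ (tgt e ≡ tgt e')

AdjacentEdges : ∀ {n} {G : Graph n} → Edge G → Edge G → Set
AdjacentEdges e e' = e ≢ e' × ShareVertex e e'

-- d(a,b) in Z_m: the smallest positive d with a + d = b in Z_m
-- (equals b - a if a < b, and m - a + b otherwise; in particular d(a,a) = m).
fwdDist : ∀ {m} → Fin m → Fin m → ℕ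
fwdDist {m} a b = if toℕ a <ᵇ toℕ b then toℕ b ∸ toℕ a else (m ∸ toℕ a) + toℕ b

cycDist : ∀ {m} → Fin m → Fin m → ℕ
cycDist a b = Data.Nat._⊓_ (fwdDist a b) (fwdDist b a)

-- An ordering of G is a bijection E(G) → Z_m (so m = |E(G)|).
Ordering : ∀ {n} → Graph n → ℕ → Set
Ordering G m = Edge G ⤖ Fin m

Separated : ∀ {n} {G : Graph n} {m} → Ordering G m → ℕ → Set
Separated {G = G} ℓ s = ∀ (e e' : Edge G) → AdjacentEdges e e' →
  s ≤ cycDist (Bijection.to ℓ e) (Bijection.to ℓ e')

-- cms(G) ≤ |E(G)|/c, i.e. for every ordering ℓ, cms(ℓ) (the largest
-- s ∈ {1,…,m} such that ℓ is s-separated) satisfies c * cms(ℓ) ≤ m.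
CmsAtMostFrac : ∀ {n} → Graph n → ℕ → Set
CmsAtMostFrac G c = ∀ m (ℓ : Ordering G m) (s : ℕ) → 1 ≤ s → s ≤ m →
  Separated ℓ s → c * s ≤ m

SubgraphOf : ∀ {p n} → Graph p → Graph n → Set
SubgraphOf {p} {n} G H = Σ (Fin p → Fin n) λ f → Injective _≡_ _≡_ f ×
  (∀ u v → adj G u v ≡ true → adj H (f u) (f v) ≡ true)

degree : ∀ {n} → Graph n → Fin n → ℕ
degree {n} G v = length (filterᵇ (adj G v) (allFin n))

Regular : ∀ {n} → ℕ → Graph n → Set
Regular k G = ∀ v → degree G v ≡ k

isEven : ℕ → Bool
isEven zero = true
isEven (suc n) = not (isEven n)

bSize : ℕ → ℕ
bSize k = if isEven k then suc k else suc (suc k)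

-- For odd k, vertices 0,…,k+1; the complement of B_k has edges
-- {0,1},{1,2} (path on 3 vertices 0-1-2) and {2i+1,2i+2} for i ≥ 1
-- (perfect matching on 3,…,k+1).  For a < b: {a,b} is a complement edge
-- iff (a,b) = (0,1) or (a odd and b = a+1).
complDir : ℕ → ℕ → Bool
complDir a b = ((a ≡ᵇ 0) ∧ (b ≡ᵇ 1)) ∨ (not (isEven a) ∧ (b ≡ᵇ suc a))

compl : ℕ → ℕ → Bool
compl a b = complDir a b ∨ complDir b a

adjBℕ : ℕ → ℕ → ℕ → Bool
adjBℕ k a b = not (a ≡ᵇ b) ∧ (if isEven k then true else not (compl a b))

≡ᵇ-sym : ∀ a b → (a ≡ᵇ b) ≡ (b ≡ᵇ a)
≡ᵇ-sym zero zero = refl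
≡ᵇ-sym zero (suc b) = refl
≡ᵇ-sym (suc a) zero = refl
≡ᵇ-sym (suc a) (suc b) = ≡ᵇ-sym a b

≡ᵇ-refl : ∀ a → (a ≡ᵇ a) ≡ true
≡ᵇ-refl zero = refl
≡ᵇ-refl (suc a) = ≡ᵇ-refl a

adjBℕ-sym : ∀ k a b → adjBℕ k a b ≡ adjBℕ k b a
adjBℕ-sym k a b = cong₂ (λ x y → not x ∧ (if isEven k then true else not y))
  (≡ᵇ-sym a b) (∨-comm (complDir a b) (complDir b a))

adjBℕ-irrefl : ∀ k a → adjBℕ k a a ≡ false
adjBℕ-irrefl k a rewrite ≡ᵇ-refl a = refl

B : (k : ℕ) → Graph (bSize k)
B k = record
  { adj    = λ u v → adjBℕ k (toℕ u) (toℕ v)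
  ; sym    = λ u v → adjBℕ-sym k (toℕ u) (toℕ v)
  ; irrefl = λ u → adjBℕ-irrefl k (toℕ u)
  }

{-# OPTIONS --safe #-}

-- Let P = B_k and suppose m < (k + 1) s.  Both for even and for odd k the number of vertices of P
-- is odd, say 2t + 1, so s consecutive edges of H contain at most t edges of P, while k + 1
-- consecutive windows of length s starting at an edge of P wrap around and contain at least
-- |E(P)| + 1 of them.  For even k this contradicts |E(P)| = (k + 1) t.  For odd k it forces every
-- window that starts or ends at an edge of P to contain exactly t of them; then at most t edges
-- of P lie between consecutive edges at the vertex w of degree k − 1, and
-- |E(P)| ≤ (t + 1) (k − 1) = 2t² − 2, whereas |E(P)| = 2t² − 1.
--
-- The regular graph is B_k together with a circulant graph on the remaining N vertices.  For odd k
-- the number N = 2h + 1 is odd, a near-perfect matching is added to the circulant, and the vertex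
-- it misses is joined to w.
module Submission where

open import Defs hiding (sym)
open import Data.Nat using (ℕ; zero; suc; _+_; _*_; _∸_; _≤_; _<_; z≤n; s≤s; _≡ᵇ_; _<ᵇ_; _≤?_; _<?_; _⊓_; _⊔_; ∣_-_∣)
open import Data.Nat.Properties
open import Data.Nat.DivMod using (_%_; _mod_; m%n<n; [m+n]%n≡m%n; %-distribˡ-+; m<n⇒m%n≡m)
open import Data.Nat.Divisibility using (_∣_; ∣m+n∣m⇒∣n; m∣m*n; ∣1⇒≡1)
open import Data.Nat.Tactic.RingSolver using (solve-∀)
open import Data.Bool using (Bool; true; false; T; not; if_then_else_; _∧_; _∨_)
import Data.Bool.Properties as Bool
open import Data.Fin using (Fin; zero; suc; toℕ; fromℕ<; splitAt; _↑ˡ_; _↑ʳ_)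
import Data.Fin.Properties as Fin
open import Data.Fin.Properties using (toℕ<n; toℕ-injective; toℕ-fromℕ<; any?; splitAt-↑ˡ; splitAt-↑ʳ; ↑ˡ-injective)
open import Data.List using (length; filterᵇ; tabulate)
open import Data.Sum using (_⊎_; inj₁; inj₂)
open import Data.Product using (Σ; ∃; ∃₂; _×_; _,_; proj₁; proj₂)
open import Data.Empty using (⊥-elim)
open import Function using (_∘_)
open import Function.Bundles using (Bijection; mk⇔)
open import Function.Definitions using (Injective)
open import Relation.Nullary using (¬_; Dec; yes; no; contradiction; _×-dec_)
open import Relation.Nullary.Decidable using (map′; does-⇔; dec-false)
open import Relation.Binary.Definitions using (tri<; tri≈; tri>)
open import Relation.Binary.PropositionalEquality
  using (_≡_; _≢_; refl; sym; trans; cong; cong₂; subst; subst₂)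
open import Axiom.UniquenessOfIdentityProofs using (module Decidable⇒UIP)
open import Algebra.Properties.Semiring.Sum +-*-semiring
  using (sum; sum-syntax; sum-cong-≗; sum-replicate-zero; ∑-comm; ∑-distrib-+; *-distribˡ-sum)

open ≤-Reasoning

-- Finite sums

sum-mono : ∀ {n} {f g : Fin n → ℕ} → (∀ i → f i ≤ g i) → sum f ≤ sum g
sum-mono {zero}  f≤g = z≤n
sum-mono {suc n} f≤g = +-mono-≤ (f≤g zero) (sum-mono (f≤g ∘ suc))

sum-const : ∀ n c → ∑[ i < n ] c ≡ n * c
sum-const zero    c = refl
sum-const (suc n) c = cong (c +_) (sum-const n c)

sum-zero : ∀ {n} {f : Fin n → ℕ} → (∀ i → f i ≡ 0) → sum f ≡ 0
sum-zero {n} f≡0 = trans (sum-cong-≗ f≡0) (sum-replicate-zero n)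

sum-ones : ∀ {n} {f : Fin n → ℕ} → (∀ i → f i ≡ 1) → sum f ≡ n
sum-ones {n} f≡1 = trans (sum-cong-≗ f≡1) (trans (sum-const n 1) (*-identityʳ n))

term≤sum : ∀ {n} (f : Fin n → ℕ) i → f i ≤ sum f
term≤sum f zero    = m≤m+n _ _
term≤sum f (suc i) = ≤-trans (term≤sum (f ∘ suc) i) (m≤n+m _ _)

sum-positive : ∀ {n} (f : Fin n → ℕ) → 1 ≤ sum f → ∃ λ i → 1 ≤ f i
sum-positive {suc n} f 1≤ with f zero in eq
... | suc _ = zero , subst (1 ≤_) (sym eq) (s≤s z≤n)
... | zero with sum-positive (f ∘ suc) 1≤
...   | i , 1≤fi = suc i , 1≤fi

-- Behind the first positive term all terms vanish. The hypothesis speaks of ordered pairs only,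
-- since its uses turn `i < j` into a positive distance between positions.
sum≤1 : ∀ {n} (f : Fin n → ℕ) → (∀ i → f i ≤ 1) →
  (∀ i j → toℕ i < toℕ j → 1 ≤ f i → ¬ 1 ≤ f j) → sum f ≤ 1
sum≤1 {zero}  f f≤1 unique = z≤n
sum≤1 {suc n} f f≤1 unique with f zero in eq
... | zero  = sum≤1 (f ∘ suc) (f≤1 ∘ suc) (λ i j i<j → unique (suc i) (suc j) (s≤s i<j))
... | suc c = begin
  suc c + sum (f ∘ suc) ≡⟨ cong (suc c +_) (sum-zero rest≡0) ⟩
  suc c + 0             ≡⟨ +-identityʳ _ ⟩
  suc c                 ≡⟨ sym eq ⟩
  f zero                ≤⟨ f≤1 zero ⟩
  1                     ∎
  where
  rest≡0 : ∀ i → f (suc i) ≡ 0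
  rest≡0 i = n<1⇒n≡0 (≰⇒> (unique zero (suc i) (s≤s z≤n) (subst (1 ≤_) (sym eq) (s≤s z≤n))))

-- The tail contributes at most its length, which forces the head up to 1; the head contributes at
-- most 1, which passes the lower bound on to the tail.
sum-saturated : ∀ {n} (f : Fin n → ℕ) → (∀ i → f i ≤ 1) → n ≤ sum f → ∀ i → f i ≡ 1
sum-saturated {suc n} f f≤1 n≤ i = ≤-antisym (f≤1 i) (1≤f i)
  where
  tail≤n : sum (f ∘ suc) ≤ n
  tail≤n = ≤-trans (sum-mono (f≤1 ∘ suc)) (≤-reflexive (trans (sum-const n 1) (*-identityʳ n)))
  1≤f : ∀ i → 1 ≤ f i
  1≤f zero    = +-cancelʳ-≤ n 1 (f zero) (≤-trans n≤ (+-monoʳ-≤ (f zero) tail≤n))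
  1≤f (suc i) = ≤-reflexive (sym (sum-saturated (f ∘ suc) (f≤1 ∘ suc)
    (+-cancelˡ-≤ 1 n _ (≤-trans n≤ (+-monoˡ-≤ _ (f≤1 zero)))) i))

bit : Bool → ℕ
bit b = if b then 1 else 0

δ : ℕ → ℕ → ℕ
δ a b = bit (a ≡ᵇ b)

sum-δ : ∀ {n c} → c < n → ∑[ i < n ] δ c (toℕ i) ≡ 1
sum-δ {suc n} {zero}  _         = cong suc (sum-zero {n} (λ _ → refl))
sum-δ {suc n} {suc c} (s≤s c<n) = sum-δ c<n

-- Windows of a sequence

window : (ℕ → ℕ) → ℕ → ℕ → ℕ
window g x L = ∑[ i < L ] g (x + toℕ i)

window-cons : ∀ g x L → window g x (suc L) ≡ g x + window g (suc x) L
window-cons g x L = cong₂ _+_ (cong g (+-identityʳ x)) (sum-cong-≗ {L} (λ i → cong g (+-suc x (toℕ i))))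

window-++ : ∀ g x K L → window g x (K + L) ≡ window g x K + window g (x + K) L
window-++ g x zero    L = sum-cong-≗ {L} (λ i → cong (λ y → g (y + toℕ i)) (sym (+-identityʳ x)))
window-++ g x (suc K) L = begin-equality
  window g x (suc (K + L))                                  ≡⟨ window-cons g x (K + L) ⟩
  g x + window g (suc x) (K + L)                            ≡⟨ cong (g x +_) (window-++ g (suc x) K L) ⟩
  g x + (window g (suc x) K + window g (suc x + K) L)       ≡⟨ sym (+-assoc (g x) _ _) ⟩
  g x + window g (suc x) K + window g (suc x + K) L         ≡⟨ cong₂ _+_ (sym (window-cons g x K)) (cong (λ y → window g y L) (sym (+-suc x K))) ⟩
  window g x (suc K) + window g (x + suc K) L               ∎

window-one : ∀ g x → window g x 1 ≡ g x
window-one g x = trans (+-identityʳ _) (cong g (+-identityʳ x))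

window-snoc : ∀ g x L → window g x (suc L) ≡ window g x L + g (x + L)
window-snoc g x L = begin-equality
  window g x (suc L)                ≡⟨ cong (window g x) (+-comm 1 L) ⟩
  window g x (L + 1)                ≡⟨ window-++ g x L 1 ⟩
  window g x L + window g (x + L) 1 ≡⟨ cong (window g x L +_) (window-one g (x + L)) ⟩
  window g x L + g (x + L)          ∎

window-mono : ∀ g x {K L} → K ≤ L → window g x K ≤ window g x L
window-mono g x {K} K≤L with m≤n⇒∃[o]m+o≡n K≤L
... | o , refl = ≤-trans (m≤m+n _ _) (≤-reflexive (sym (window-++ g x K o)))

window-suffix : ∀ g x K L → window g (x + K) L ≤ window g x (K + L)
window-suffix g x K L = ≤-trans (m≤n+m _ _) (≤-reflexive (sym (window-++ g x K L)))

window-sum : ∀ {p} (b : Fin p → ℕ → ℕ) x L →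
  ∑[ v < p ] window (b v) x L ≡ window (λ y → ∑[ v < p ] b v y) x L
window-sum b x L = ∑-comm (λ v i → b v (x + toℕ {L} i))

module _ {m} (g : ℕ → ℕ) (periodic : ∀ x → g (x + m) ≡ g x) where

  periodic-* : ∀ x k → g (x + k * m) ≡ g x
  periodic-* x zero    = cong g (+-identityʳ x)
  periodic-* x (suc k) = begin-equality
    g (x + (m + k * m)) ≡⟨ cong g (trans (cong (x +_) (+-comm m (k * m))) (sym (+-assoc x (k * m) m))) ⟩
    g (x + k * m + m)   ≡⟨ periodic (x + k * m) ⟩
    g (x + k * m)       ≡⟨ periodic-* x k ⟩
    g x                 ∎

  window-periodic : ∀ x k L → window g (x + k * m) L ≡ window g x L
  window-periodic x k L = sum-cong-≗ {L} λ i →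
    trans (cong g (+-*-swap x (k * m) (toℕ i))) (periodic-* (x + toℕ i) k)
    where
    +-*-swap : ∀ x y z → x + y + z ≡ x + z + y
    +-*-swap = solve-∀

  -- Moving the start by one position removes `g x` and adds `g (x + m)`, which are equal by
  -- periodicity.
  window-full : ∀ x → window g x m ≡ window g 0 m
  window-full zero    = refl
  window-full (suc x) = trans (+-cancelˡ-≡ (g x) _ _ (begin-equality
    g x + window g (suc x) m  ≡⟨ sym (window-cons g x m) ⟩
    window g x (suc m)        ≡⟨ window-snoc g x m ⟩
    window g x m + g (x + m)  ≡⟨ cong (window g x m +_) (periodic x) ⟩
    window g x m + g x        ≡⟨ +-comm _ (g x) ⟩
    g x + window g x m        ∎)) (window-full x)

-- Counting in cyclic patterns

2a≤1+2b⇒a≤b : ∀ {a b} → 2 * a ≤ suc (2 * b) → a ≤ b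
2a≤1+2b⇒a≤b {a} {b} 2a≤ = ≮⇒≥ λ b<a → <-irrefl refl (begin-strict
  suc (2 * b)       <⟨ n<1+n _ ⟩
  suc (suc (2 * b)) ≡⟨ sym (*-suc 2 b) ⟩
  2 * suc b         ≤⟨ *-monoʳ-≤ 2 b<a ⟩
  2 * a             ≤⟨ 2a≤ ⟩
  suc (2 * b)       ∎)

-- Positions run over ℕ and are read modulo m.  With P the subgraph under consideration,
-- a x = 1 iff the edge at position x lies in P, and b v x = 1 iff that edge moreover contains v.
record CyclicPattern (p m s : ℕ) : Set where
  field
    a           : ℕ → ℕ
    b           : Fin p → ℕ → ℕ
    a≤1         : ∀ x → a x ≤ 1
    a-periodic  : ∀ x → a (x + m) ≡ a x
    b-periodic  : ∀ v x → b v (x + m) ≡ b v x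
    handshake   : ∀ x → ∑[ v < p ] b v x ≡ 2 * a x
    matching    : ∀ v x → window (b v) x s ≤ 1
    -- An edge is determined by its ends, so an edge of P and its incidences recur only after a full
    -- turn.
    separating  : ∀ x d → 1 ≤ a x → (∀ v → b v x ≡ b v (x + suc d)) → m ≤ suc d

  -- One period reads every edge of H once, so in the application this is the number of edges of P,
  -- and `deg v` is the degree of `v` in P.
  size : ℕ
  size = window a 0 m

  deg : Fin p → ℕ
  deg v = window (b v) 0 m

  handshake-window : ∀ x L → ∑[ v < p ] window (b v) x L ≡ 2 * window a x L
  handshake-window x L = begin-equality
    ∑[ v < p ] window (b v) x L           ≡⟨ window-sum b x L ⟩
    window (λ y → ∑[ v < p ] b v y) x L   ≡⟨ sum-cong-≗ {L} (λ i → handshake (x + toℕ i)) ⟩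
    window (λ y → 2 * a y) x L            ≡⟨ sym (*-distribˡ-sum {L} 2 (λ i → a (x + toℕ i))) ⟩
    2 * window a x L                      ∎

  -- By the handshake identity the incidences of all vertices sum to 0. This allows stretches
  -- without edges of P to be dropped from the count at any vertex.
  b-window-zero : ∀ {x L} → window a x L ≡ 0 → ∀ v → window (b v) x L ≡ 0
  b-window-zero {x} {L} a≡0 v = n≤0⇒n≡0 (begin
    window (b v) x L             ≤⟨ term≤sum (λ u → window (b u) x L) v ⟩
    ∑[ u < p ] window (b u) x L  ≡⟨ handshake-window x L ⟩
    2 * window a x L             ≡⟨ cong (2 *_) a≡0 ⟩
    0                            ∎)

-- The hypothesis `m<cs` is the negation of the bound to be proved. Writing the window length as
-- `suc s′` makes `z + s′` the last position of the window at `z`.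
module Tight t k {m s′} (C : CyclicPattern (suc (2 * t)) m (suc s′))
  (s≤m : suc s′ ≤ m) (m<cs : m < suc k * suc s′) where

  open CyclicPattern C

  private
    s p : ℕ
    s = suc s′
    p = suc (2 * t)

  -- The edges of P in a window form a matching on 2t + 1 vertices, and their 2 · (number of edges)
  -- ends are distinct; parity gives the bound t.
  window≤t : ∀ x → window a x s ≤ t
  window≤t x = 2a≤1+2b⇒a≤b (begin
    2 * window a x s             ≡⟨ sym (handshake-window x s) ⟩
    ∑[ v < p ] window (b v) x s  ≤⟨ sum-mono (λ v → matching v x) ⟩
    ∑[ v < p ] 1                 ≡⟨ sum-ones {p} (λ _ → refl) ⟩
    p                            ∎)

  windows≤t : ∀ n x → window a x (n * s) ≤ n * t
  windows≤t zero    x = z≤n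
  windows≤t (suc n) x = begin
    window a x (s + n * s)                 ≡⟨ window-++ a x s (n * s) ⟩
    window a x s + window a (x + s) (n * s) ≤⟨ +-mono-≤ (window≤t x) (windows≤t n (x + s)) ⟩
    t + n * t                              ∎

  -- As m + 1 ≤ (k + 1) s, the k + 1 windows from `x` reach position `x + m`, where the edge at `x`
  -- is counted a second time; this makes the inequality strict. All windows but the first are
  -- bounded by t.
  start-tight : ∀ {x} → 1 ≤ a x → size < window a x s + k * t
  start-tight {x} 1≤ax = begin-strict
    size                                      ≡⟨ sym (window-full a a-periodic x) ⟩
    window a x m                              <⟨ m<m+n _ (subst (1 ≤_) (sym (a-periodic x)) 1≤ax) ⟩
    window a x m + a (x + m)                  ≡⟨ sym (window-snoc a x m) ⟩
    window a x (suc m)                        ≤⟨ window-mono a x m<cs ⟩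
    window a x (s + k * s)                    ≡⟨ window-++ a x s (k * s) ⟩
    window a x s + window a (x + s) (k * s)   ≤⟨ +-monoʳ-≤ _ (windows≤t k (x + s)) ⟩
    window a x s + k * t                      ∎

  -- The k windows preceding [z, z + s) are those from z − k s, moved up by k m to stay in ℕ.
  end-tight : ∀ {z} → 1 ≤ a (z + s′) → size < k * t + window a z s
  end-tight {z} 1≤a with m≤n⇒∃[o]m+o≡n s≤m | m≤n⇒∃[o]m+o≡n m<cs
  ... | o , s+o≡m | r , 1+m+r≡cs = begin-strict
    size                                            ≡⟨ sym (window-full a a-periodic y) ⟩
    window a y m                                    <⟨ m<m+n _ (subst (1 ≤_) (sym last≡) 1≤a) ⟩
    window a y m + a (y + m)                        ≡⟨ sym (window-snoc a y m) ⟩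
    window a y (suc m)                              ≤⟨ window-suffix a x r (suc m) ⟩
    window a x (r + suc m)                          ≡⟨ cong (window a x) (trans (+-comm r (suc m)) 1+m+r≡cs) ⟩
    window a x (s + k * s)                          ≡⟨ cong (window a x) (+-comm s (k * s)) ⟩
    window a x (k * s + s)                          ≡⟨ window-++ a x (k * s) s ⟩
    window a x (k * s) + window a (x + k * s) s     ≤⟨ +-monoˡ-≤ _ (windows≤t k x) ⟩
    k * t + window a (x + k * s) s                  ≡⟨ cong (λ w → k * t + window a w s) x+ks≡ ⟩
    k * t + window a (z + k * m) s                  ≡⟨ cong (k * t +_) (window-periodic a a-periodic z k s) ⟩
    k * t + window a z s                            ∎
    where
    -- Since `s + o ≡ m`, the k windows from `x` end where the window at `z + k * m` begins. The
    -- surplus `r` is skipped, so that exactly m + 1 positions from `y` remain, the last of them a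
    -- copy of `z + s′`.
    x y : ℕ
    x = z + k * o
    y = x + r
    distrib : ∀ z k o s → z + k * o + k * s ≡ z + k * (s + o)
    distrib = solve-∀
    x+ks≡ : x + k * s ≡ z + k * m
    x+ks≡ = trans (distrib z k o s) (cong (λ w → z + k * w) s+o≡m)
    rearrange : ∀ x r m k s′ → suc m + r ≡ suc k * suc s′ → x + r + m ≡ x + k * suc s′ + s′
    rearrange x r m k s′ eq = suc-injective (trans (lhs x r m) (trans (cong (x +_) eq) (rhs x k s′)))
      where
      lhs : ∀ x r m → suc (x + r + m) ≡ x + (suc m + r)
      lhs = solve-∀
      rhs : ∀ x k s′ → x + suc k * suc s′ ≡ suc (x + k * suc s′ + s′)
      rhs = solve-∀
    swap : ∀ z w s′ → z + w + s′ ≡ z + s′ + w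
    swap = solve-∀
    last≡ : a (y + m) ≡ a (z + s′)
    last≡ = trans (cong a (trans (rearrange x r m k s′ 1+m+r≡cs)
                   (trans (cong (_+ s′) x+ks≡) (swap z (k * m) s′))))
                  (periodic-* a a-periodic (z + s′) k)

  -- Any position that holds an edge of P can serve as the start in `start-tight`; its first window
  -- is then bounded by t as well.
  size<ct : 1 ≤ size → size < suc k * t
  size<ct 1≤size with sum-positive {m} (a ∘ toℕ) 1≤size
  ... | i , 1≤a = ≤-trans (start-tight 1≤a) (+-monoˡ-≤ (k * t) (window≤t (toℕ i)))

  -- Together with `size<ct` the first hypothesis leaves no slack, so the bound t is attained by
  -- every window that starts or ends at an edge of P. The second one ensures that an interval with
  -- at most t edges of P is shorter than a full turn.
  module Gap (ct≤1+size : suc k * t ≤ suc size) (t<size : t < size)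
    (w : Fin (suc (2 * t))) where

    start≡t : ∀ {x} → 1 ≤ a x → window a x s ≡ t
    start≡t 1≤a = ≤-antisym (window≤t _)
      (+-cancelʳ-≤ (k * t) t _ (≤-trans ct≤1+size (start-tight 1≤a)))

    end≡t : ∀ {z} → 1 ≤ a (z + s′) → window a z s ≡ t
    end≡t {z} 1≤a = ≤-antisym (window≤t _)
      (+-cancelˡ-≤ (k * t) t _ (≤-trans (≤-reflexive (+-comm (k * t) t))
        (≤-trans ct≤1+size (end-tight {z} 1≤a))))

    -- The t edges of P in the window have 2t distinct ends, so they miss exactly one of the 2t + 1
    -- vertices, and `w` is missed. Adding the indicator of `w` gives 2t + 1 terms, each at most 1,
    -- with sum 2t + 1.
    covers : ∀ {x} → window a x s ≡ t → window (b w) x s ≡ 0 →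
      ∀ v → window (b v) x s + δ (toℕ w) (toℕ v) ≡ 1
    covers {x} a≡t w≡0 = sum-saturated _ ≤1 (begin
      suc (2 * t)
        ≡⟨ +-comm 1 (2 * t) ⟩
      2 * t + 1
        ≡⟨ cong₂ _+_ (trans (cong (2 *_) (sym a≡t)) (sym (handshake-window x s)))
                     (sym (sum-δ {p} (toℕ<n w))) ⟩
      ∑[ v < p ] window (b v) x s + ∑[ v < p ] δ (toℕ w) (toℕ v)
        ≡⟨ sym (∑-distrib-+ {p} (λ v → window (b v) x s) (λ v → δ (toℕ w) (toℕ v))) ⟩
      ∑[ v < p ] (window (b v) x s + δ (toℕ w) (toℕ v))
        ∎)
      where
      ≤1 : ∀ v → window (b v) x s + δ (toℕ w) (toℕ v) ≤ 1
      ≤1 v with toℕ w ≡ᵇ toℕ v in eq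
      ... | false = ≤-trans (≤-reflexive (+-identityʳ _)) (matching v x)
      ... | true rewrite sym (toℕ-injective (≡ᵇ⇒≡ (toℕ w) (toℕ v) (subst T (sym eq) _))) | w≡0 = ≤-refl

    -- If an interval free of w begins and ends with an edge of P and contains t + 1 of them, then
    -- its first and its last window are both perfect matchings of P − w, and they differ in the
    -- first and last edge only; these two edges have the same ends, hence coincide.
    no-tight-gap : ∀ {L x} → s ≤ L → 1 ≤ a x → 1 ≤ a (x + L) → window (b w) x (suc L) ≡ 0 →
      window a x L ≤ t → ¬ window a (suc x) L ≤ t
    no-tight-gap {L} {x} s≤L 1≤ax 1≤a[x+L] w≡0 shorter shorter′ with m≤n⇒∃[o]m+o≡n s≤L
    ... | r , refl = <⇒≱ t<size (begin
      size             ≡⟨ sym (window-full a a-periodic x) ⟩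
      window a x m     ≤⟨ window-mono a x (separating x (s′ + r) 1≤ax same) ⟩
      window a x L     ≤⟨ shorter ⟩
      t                ∎)
      where
      z : ℕ
      z = x + suc r
      z+s′≡x+L : z + s′ ≡ x + L
      z+s′≡x+L = shift x r s′
        where
        shift : ∀ x r s → x + suc r + s ≡ x + (suc s + r)
        shift = solve-∀
      1+L≡ : suc L ≡ suc r + s
      1+L≡ = cong suc (+-comm s r)
      1≤az : 1 ≤ a (z + s′)
      1≤az = subst (λ y → 1 ≤ a y) (sym z+s′≡x+L) 1≤a[x+L]
      middle : ∀ {y z} → y + z ≤ t → y ≡ t → z ≡ 0
      middle {y} {z} y+z≤t refl = n≤0⇒n≡0 (+-cancelˡ-≤ y z 0 (≤-trans y+z≤t (≤-reflexive (sym (+-identityʳ y)))))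
      -- The first window already holds t edges of P, so the `r` positions behind it hold none;
      -- `before` is the mirror image for the last window.
      after : window a (x + s) r ≡ 0
      after = middle (≤-trans (≤-reflexive (sym (window-++ a x s r))) shorter) (start≡t 1≤ax)
      before : window a (suc x) r ≡ 0
      before = middle {window a z s} {window a (suc x) r} (≤-trans (≤-reflexive (begin-equality
        window a z s + window a (suc x) r          ≡⟨ +-comm (window a z s) _ ⟩
        window a (suc x) r + window a z s          ≡⟨ cong (λ y → window a (suc x) r + window a y s) (+-suc x r) ⟩
        window a (suc x) r + window a (suc x + r) s ≡⟨ sym (window-++ a (suc x) r s) ⟩
        window a (suc x) (r + s)                   ≡⟨ cong (window a (suc x)) (+-comm r s) ⟩
        window a (suc x) L                         ∎)) shorter′) (end≡t {z} 1≤az)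
      front : ∀ v → window (b v) x (suc L) ≡ window (b v) x s + b v (x + L)
      front v = begin-equality
        window (b v) x (suc L)                                        ≡⟨ window-snoc (b v) x L ⟩
        window (b v) x (s + r) + b v (x + L)                          ≡⟨ cong (_+ b v (x + L)) (window-++ (b v) x s r) ⟩
        window (b v) x s + window (b v) (x + s) r + b v (x + L)       ≡⟨ cong (λ y → window (b v) x s + y + b v (x + L)) (b-window-zero {x + s} {r} after v) ⟩
        window (b v) x s + 0 + b v (x + L)                            ≡⟨ cong (_+ b v (x + L)) (+-identityʳ _) ⟩
        window (b v) x s + b v (x + L)                                ∎
      back : ∀ v → window (b v) x (suc L) ≡ window (b v) z s + b v x
      back v = begin-equality
        window (b v) x (suc L)                                        ≡⟨ cong (window (b v) x) 1+L≡ ⟩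
        window (b v) x (suc r + s)                                    ≡⟨ window-++ (b v) x (suc r) s ⟩
        window (b v) x (suc r) + window (b v) z s                     ≡⟨ cong (_+ window (b v) z s) (window-cons (b v) x r) ⟩
        b v x + window (b v) (suc x) r + window (b v) z s             ≡⟨ cong (λ y → b v x + y + window (b v) z s) (b-window-zero {suc x} {r} before v) ⟩
        b v x + 0 + window (b v) z s                                  ≡⟨ cong (_+ window (b v) z s) (+-identityʳ (b v x)) ⟩
        b v x + window (b v) z s                                      ≡⟨ +-comm (b v x) _ ⟩
        window (b v) z s + b v x                                      ∎
      same-window : ∀ v → window (b v) x s ≡ window (b v) z s
      same-window v = +-cancelʳ-≡ (δ (toℕ w) (toℕ v)) _ _ (trans
        (covers (start≡t 1≤ax) (m+n≡0⇒m≡0 _ (trans (sym (front w)) w≡0)) v)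
        (sym (covers {z} (end≡t {z} 1≤az) (m+n≡0⇒m≡0 _ (trans (sym (back w)) w≡0)) v)))
      same : ∀ v → b v x ≡ b v (x + L)
      same v = +-cancelˡ-≡ (window (b v) x s) _ _ (begin-equality
        window (b v) x s + b v x        ≡⟨ cong (_+ b v x) (same-window v) ⟩
        window (b v) z s + b v x        ≡⟨ sym (back v) ⟩
        window (b v) x (suc L)          ≡⟨ front v ⟩
        window (b v) x s + b v (x + L)  ∎)

    -- Induction on the length: without its first or its last position the interval has at most t
    -- edges of P, which settles the case that one of these positions is outside P. Otherwise the
    -- interval fits into one window or is excluded by `no-tight-gap`.
    gap : ∀ L x → window (b w) x L ≡ 0 → window a x L ≤ t
    gap zero    x w≡0 = z≤n
    gap (suc L) x w≡0 = extend
      (gap L x (m+n≡0⇒m≡0 _ (trans (sym (window-snoc (b w) x L)) w≡0)))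
      (gap L (suc x) (m+n≡0⇒n≡0 (b w x) (trans (sym (window-cons (b w) x L)) w≡0)))
      where
      extend : window a x L ≤ t → window a (suc x) L ≤ t → window a x (suc L) ≤ t
      extend init≤t tail≤t with a x in ax | a (x + L) in az
      ... | zero | _ = begin
        window a x (suc L)       ≡⟨ window-cons a x L ⟩
        a x + window a (suc x) L ≡⟨ cong (_+ window a (suc x) L) ax ⟩
        window a (suc x) L       ≤⟨ tail≤t ⟩
        t                        ∎
      ... | suc _ | zero = begin
        window a x (suc L)       ≡⟨ window-snoc a x L ⟩
        window a x L + a (x + L) ≡⟨ cong (window a x L +_) az ⟩
        window a x L + 0         ≡⟨ +-identityʳ _ ⟩
        window a x L             ≤⟨ init≤t ⟩
        t                        ∎
      ... | suc _ | suc _ with s ≤? L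
      ...   | no s≰L = ≤-trans (window-mono a x (≰⇒> s≰L)) (window≤t x)
      ...   | yes s≤L = ⊥-elim (no-tight-gap s≤L
        (subst (1 ≤_) (sym ax) (s≤s z≤n)) (subst (1 ≤_) (sym az) (s≤s z≤n)) w≡0 init≤t tail≤t)

    -- The interval is cut behind its last edge at `w`; the first piece is empty if there is no such
    -- edge. In `close`, each edge at `w` pays for itself and for the at most t edges of P since the
    -- preceding edge at `w` or the start, which gives the factor t + 1.
    up-to-last : ∀ L x → ∃₂ λ L₁ L₂ → L₁ + L₂ ≡ L ×
      window a x L₁ ≤ suc t * window (b w) x L₁ × window (b w) (x + L₁) L₂ ≡ 0
    close      : ∀ L x → 1 ≤ b w (x + L) → window a x (suc L) ≤ suc t * window (b w) x (suc L)

    up-to-last zero    x = 0 , 0 , refl , z≤n , refl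
    up-to-last (suc L) x with b w (x + L) in eq
    ... | suc _ = suc L , 0 , +-identityʳ (suc L) , close L x (subst (1 ≤_) (sym eq) (s≤s z≤n)) , refl
    ... | zero with up-to-last L x
    ...   | L₁ , L₂ , refl , bound , free = L₁ , suc L₂ , +-suc L₁ L₂ , bound , (begin-equality
      window (b w) (x + L₁) (suc L₂)                      ≡⟨ window-snoc (b w) (x + L₁) L₂ ⟩
      window (b w) (x + L₁) L₂ + b w (x + L₁ + L₂)        ≡⟨ cong₂ _+_ free (trans (cong (b w) (+-assoc x L₁ L₂)) eq) ⟩
      0                                                   ∎)

    close L x 1≤bw with up-to-last L x
    ... | L₁ , L₂ , refl , bound , free = begin
      window a x (suc L)                                      ≡⟨ window-snoc a x L ⟩
      window a x (L₁ + L₂) + a (x + L)                        ≡⟨ cong (_+ a (x + L)) (window-++ a x L₁ L₂) ⟩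
      window a x L₁ + window a (x + L₁) L₂ + a (x + L)        ≤⟨ +-mono-≤ (+-mono-≤ bound (gap L₂ (x + L₁) free)) (a≤1 (x + L)) ⟩
      suc t * window (b w) x L₁ + t + 1                       ≡⟨ regroup t (window (b w) x L₁) ⟩
      suc t * (window (b w) x L₁ + 1)                         ≤⟨ *-monoʳ-≤ (suc t) (+-mono-≤ (window-mono (b w) x (m≤m+n L₁ L₂)) 1≤bw) ⟩
      suc t * (window (b w) x L + b w (x + L))                ≡⟨ cong (suc t *_) (sym (window-snoc (b w) x L)) ⟩
      suc t * window (b w) x (suc L)                          ∎
      where
      regroup : ∀ t y → suc t * y + t + 1 ≡ suc t * (y + 1)
      regroup = solve-∀

    -- A full turn that begins right after an edge at `w` also ends with that edge, so nothing is
    -- left over behind the last edge at `w`. If `w` had no edge at all, `gap` would apply to the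
    -- whole turn and contradict `t<size`.
    size≤[1+t]deg : size ≤ suc t * deg w
    size≤[1+t]deg with deg w in deg≡
    ... | zero  = ⊥-elim (<⇒≱ t<size (gap m 0 deg≡))
    ... | suc d with sum-positive {m} (b w ∘ toℕ) (subst (1 ≤_) (sym deg≡) (s≤s z≤n)) | m≤n⇒∃[o]m+o≡n s≤m
    ...   | i , 1≤b | o , refl = begin
      size                                       ≡⟨ sym (window-full a a-periodic y) ⟩
      window a y m                               ≤⟨ close (s′ + o) y (subst (1 ≤_) (sym end≡) 1≤b) ⟩
      suc t * window (b w) y m                   ≡⟨ cong (suc t *_) (window-full (b w) (b-periodic w) y) ⟩
      suc t * deg w                              ≡⟨ cong (suc t *_) deg≡ ⟩
      suc t * suc d                              ∎
      where
      y : ℕ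
      y = suc (toℕ i)
      end≡ : b w (y + (s′ + o)) ≡ b w (toℕ i)
      end≡ = trans (cong (b w) (sym (+-suc (toℕ i) (s′ + o)))) (b-periodic w (toℕ i))

-- Indicators of equality

≡ᵇ-false : ∀ {a b} → a ≢ b → (a ≡ᵇ b) ≡ false
≡ᵇ-false {a} {b} a≢b with a ≡ᵇ b in eq
... | false = refl
... | true  = ⊥-elim (a≢b (≡ᵇ⇒≡ a b (subst T (sym eq) _)))

δ-refl : ∀ a → δ a a ≡ 1
δ-refl a = cong bit (≡ᵇ-refl a)

δ-≢ : ∀ {a b} → a ≢ b → δ a b ≡ 0
δ-≢ a≢b = cong bit (≡ᵇ-false a≢b)

1≤δ⇒≡ : ∀ {a b} → 1 ≤ δ a b → a ≡ b
1≤δ⇒≡ {a} {b} 1≤ with a ≡ᵇ b in eq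
... | true = ≡ᵇ⇒≡ a b (subst T (sym eq) _)

1≤δ-toℕ⇒≡ : ∀ {n} (i j : Fin n) → 1 ≤ δ (toℕ i) (toℕ j) → i ≡ j
1≤δ-toℕ⇒≡ i j = toℕ-injective ∘ 1≤δ⇒≡

δ≤1 : ∀ a b → δ a b ≤ 1
δ≤1 a b with a ≡ᵇ b
... | true  = ≤-refl
... | false = z≤n

δ+δ≤1 : ∀ {a b} c → a ≢ b → δ a c + δ b c ≤ 1
δ+δ≤1 {a} {b} c a≢b with a ≟ c
... | yes refl = ≤-reflexive (cong₂ _+_ (δ-refl a) (δ-≢ (a≢b ∘ sym)))
... | no  a≢c  = ≤-trans (≤-reflexive (cong (_+ δ b c) (δ-≢ a≢c))) (δ≤1 b c)

1≤m+n⇒1≤m⊎1≤n : ∀ m {n} → 1 ≤ m + n → 1 ≤ m ⊎ 1 ≤ n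
1≤m+n⇒1≤m⊎1≤n zero    1≤n = inj₂ 1≤n
1≤m+n⇒1≤m⊎1≤n (suc m) _   = inj₁ (s≤s z≤n)

1≤m*n⇒1≤m×1≤n : ∀ m n → 1 ≤ m * n → 1 ≤ m × 1 ≤ n
1≤m*n⇒1≤m×1≤n (suc m) (suc n) _  = s≤s z≤n , s≤s z≤n
1≤m*n⇒1≤m×1≤n (suc m) zero    1≤ = ⊥-elim (<⇒≱ 1≤ (≤-reflexive (*-zeroʳ m)))

-- Distances in ℤ_m

-- Encodes i + d = j in ℤ_m with at most one wrap-around, free of subtraction and remainders.
Ahead : ∀ {m} → Fin m → Fin m → ℕ → Set
Ahead {m} i j d = toℕ j ≡ toℕ i + d ⊎ toℕ i + d ≡ m + toℕ j

module _ {m} {i j : Fin m} {d} (0<d : 0 < d) (d<m : d < m) where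

  ahead⇒≢ : Ahead i j d → i ≢ j
  ahead⇒≢ (inj₁ j≡i+d)   refl = <⇒≢ (m<m+n _ 0<d) j≡i+d
  ahead⇒≢ (inj₂ i+d≡m+j) refl = <⇒≢ d<m (+-cancelˡ-≡ (toℕ i) _ _ (trans i+d≡m+j (+-comm m _)))

  -- The two cases of `Ahead` match the two branches of `fwdDist`; the mixed cases are excluded by
  -- `0<d` and `d<m`.
  fwdDist≤ : Ahead i j d → fwdDist i j ≤ d
  fwdDist≤ ahead with toℕ i <ᵇ toℕ j in eq | ahead
  ... | true  | inj₁ j≡i+d   = ≤-reflexive (trans (cong (_∸ toℕ i) j≡i+d) (m+n∸m≡n (toℕ i) d))
  ... | true  | inj₂ i+d≡m+j = ⊥-elim (<-irrefl i+d≡m+j (begin-strict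
    toℕ i + d ≡⟨ +-comm (toℕ i) d ⟩
    d + toℕ i <⟨ +-mono-< d<m (<ᵇ⇒< (toℕ i) (toℕ j) (subst T (sym eq) _)) ⟩
    m + toℕ j ∎))
  ... | false | inj₁ j≡i+d   = ⊥-elim (subst T eq (<⇒<ᵇ (subst (toℕ i <_) (sym j≡i+d) (m<m+n _ 0<d))))
  ... | false | inj₂ i+d≡m+j = +-cancelˡ-≤ (toℕ i) _ _ (≤-reflexive (begin-equality
    toℕ i + (m ∸ toℕ i + toℕ j) ≡⟨ sym (+-assoc (toℕ i) _ _) ⟩
    toℕ i + (m ∸ toℕ i) + toℕ j ≡⟨ cong (_+ toℕ j) (m+[n∸m]≡n (<⇒≤ (toℕ<n i))) ⟩
    m + toℕ j                   ≡⟨ sym i+d≡m+j ⟩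
    toℕ i + d                   ∎))

toℕ-mod : ∀ x m′ → toℕ (x mod suc m′) ≡ x % suc m′
toℕ-mod x m′ = toℕ-fromℕ< (m%n<n x (suc m′))

mod-ahead : ∀ x m′ {d} → d < suc m′ → Ahead (x mod suc m′) ((x + d) mod suc m′) d
mod-ahead x m′ {d} d<m rewrite toℕ-mod x m′ | toℕ-mod (x + d) m′ = go
  where
  m r : ℕ
  m = suc m′
  r = x % m
  reduce : (x + d) % m ≡ (r + d) % m
  reduce = trans (%-distribˡ-+ x d m) (cong (λ y → (r + y) % m) (m<n⇒m%n≡m d<m))
  go : (x + d) % m ≡ r + d ⊎ r + d ≡ m + (x + d) % m
  go with r + d <? m
  ... | yes r+d<m = inj₁ (trans reduce (m<n⇒m%n≡m r+d<m))
  ... | no  r+d≮m with m≤n⇒∃[o]m+o≡n (≮⇒≥ r+d≮m)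
  ...   | o , m+o≡r+d = inj₂ (trans (sym m+o≡r+d) (cong (m +_) (sym (begin-equality
    (x + d) % m ≡⟨ reduce ⟩
    (r + d) % m ≡⟨ cong (_% m) (trans (sym m+o≡r+d) (+-comm m o)) ⟩
    (o + m) % m ≡⟨ [m+n]%n≡m%n o m ⟩
    o % m       ≡⟨ m<n⇒m%n≡m (+-cancelˡ-< m o m (subst (_< m + m) (sym m+o≡r+d) (+-mono-< (m%n<n x m) d<m))) ⟩
    o           ∎))))

-- The cyclic pattern of a copy of P in an ordered graph

-- Proofs of `<` and of Boolean equations are unique, so only the ends matter.
edge-≡ : ∀ {n} {G : Graph n} {e e′ : Edge G} → src e ≡ src e′ → tgt e ≡ tgt e′ → e ≡ e′
edge-≡ {e = edge u v lt adj} {edge .u .v lt′ adj′} refl refl =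
  cong₂ (edge u v) (<-irrelevant lt lt′) (Decidable⇒UIP.≡-irrelevant Bool._≟_ adj adj′)

degree-sum : ∀ {n} (G : Graph n) v → degree G v ≡ ∑[ j < n ] bit (adj G v j)
degree-sum {n} G v = count (adj G v) (λ j → j)
  where
  count : ∀ {A : Set} (q : A → Bool) {n} (g : Fin n → A) →
    length (filterᵇ q (tabulate g)) ≡ ∑[ j < n ] bit (q (g j))
  count q {zero}  g = refl
  count q {suc n} g with q (g zero)
  ... | true  = cong suc (count q (g ∘ suc))
  ... | false = count q (g ∘ suc)

module OrderedCopy {p n} (P : Graph p) (H : Graph n) (f : Fin p → Fin n) (f-injective : Injective _≡_ _≡_ f)
  (hom : ∀ u v → adj P u v ≡ true → adj H (f u) (f v) ≡ true)
  {m′ s′} (ℓ : Ordering H (suc m′)) (s≤m : suc s′ ≤ suc m′) (separated : Separated ℓ (suc s′)) where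

  private
    m s : ℕ
    m = suc m′
    s = suc s′

  open Bijection ℓ using (to; injective; surjective)

  edgeAt : ℕ → Edge H
  edgeAt x = proj₁ (surjective (x mod m))

  to-edgeAt : ∀ x → to (edgeAt x) ≡ x mod m
  to-edgeAt x = proj₂ (surjective (x mod m)) refl

  edgeAt-periodic : ∀ x → edgeAt (x + m) ≡ edgeAt x
  edgeAt-periodic x = cong (λ y → proj₁ (surjective y))
    (toℕ-injective (trans (toℕ-mod (x + m) m′) (trans ([m+n]%n≡m%n x m) (sym (toℕ-mod x m′)))))

  edgeAt-to : ∀ e → edgeAt (toℕ (to e)) ≡ e
  edgeAt-to e = injective (trans (to-edgeAt (toℕ (to e))) (toℕ-injective
    (trans (toℕ-mod (toℕ (to e)) m′) (m<n⇒m%n≡m (toℕ<n (to e))))))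

  edgeAt-distinct : ∀ x {d} → 0 < d → d < m → edgeAt x ≢ edgeAt (x + d)
  edgeAt-distinct x {d} 0<d d<m eq = ahead⇒≢ 0<d d<m (mod-ahead x m′ d<m)
    (trans (sym (to-edgeAt x)) (trans (cong to eq) (to-edgeAt (x + d))))

  record IsCopy (e : Edge H) (u v : Fin p) : Set where
    constructor is-copy
    field
      src≡ : f u ≡ src e
      tgt≡ : f v ≡ tgt e
      uv∈P : adj P u v ≡ true

  Copied : Edge H → Set
  Copied e = ∃ λ u → ∃ λ v → IsCopy e u v

  copied? : ∀ e → Dec (Copied e)
  copied? e = any? λ u → any? λ v → map′
    (λ (us , vt , uv) → is-copy us vt uv) (λ (is-copy us vt uv) → us , vt , uv)
    ((f u Fin.≟ src e) ×-dec (f v Fin.≟ tgt e) ×-dec (adj P u v Bool.≟ true))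

  copy-irrefl : ∀ {e u v} → IsCopy e u v → toℕ u ≢ toℕ v
  copy-irrefl (is-copy _ _ uv) u≡v with toℕ-injective u≡v
  ... | refl with trans (sym uv) (irrefl P _)
  ...   | ()

  -- The embedding `f` need not be monotone, so either end may be the source of the edge in H.
  Joins : Edge H → Fin p → Fin p → Set
  Joins e u v = IsCopy e u v ⊎ IsCopy e v u

  -- With opposite orientations, `f u` and `f v` would each be smaller than the other.
  joins-unique : ∀ {e e′ u v} → Joins e u v → Joins e′ u v → e ≡ e′
  joins-unique (inj₁ (is-copy us vt _)) (inj₁ (is-copy us′ vt′ _)) = edge-≡ (trans (sym us) us′) (trans (sym vt) vt′)
  joins-unique (inj₂ (is-copy us vt _)) (inj₂ (is-copy us′ vt′ _)) = edge-≡ (trans (sym us) us′) (trans (sym vt) vt′)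
  joins-unique {e} {e′} (inj₁ (is-copy us vt _)) (inj₂ (is-copy vs′ ut′ _)) =
    ⊥-elim (<-asym (lt e) (subst₂ (λ y z → toℕ y < toℕ z) (trans (sym vs′) vt) (trans (sym ut′) us) (lt e′)))
  joins-unique {e} {e′} (inj₂ (is-copy vs ut _)) (inj₁ (is-copy us′ vt′ _)) =
    ⊥-elim (<-asym (lt e) (subst₂ (λ y z → toℕ y < toℕ z) (trans (sym us′) ut) (trans (sym vt′) vs) (lt e′)))

  -- This function and the next two take the decision rather than the edge, so that matching on it
  -- exposes the ends in P.
  inside : ∀ {e} → Dec (Copied e) → ℕ
  inside (yes _) = 1
  inside (no _)  = 0

  incidence : ∀ {e} → Dec (Copied e) → Fin p → ℕ
  incidence (yes (i , j , _)) v = δ (toℕ i) (toℕ v) + δ (toℕ j) (toℕ v)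
  incidence (no _)            v = 0

  -- Refines `incidence` by recording the other end as well: it is 1 exactly when the edge is the
  -- image of the pair `u`, `v`. Summing over `v` recovers `incidence`.
  link : ∀ {e} → Dec (Copied e) → Fin p → Fin p → ℕ
  link (yes (i , j , _)) u v = δ (toℕ i) (toℕ u) * δ (toℕ j) (toℕ v) + δ (toℕ j) (toℕ u) * δ (toℕ i) (toℕ v)
  link (no _)            u v = 0

  inside≤1 : ∀ {e} (d : Dec (Copied e)) → inside d ≤ 1
  inside≤1 (yes _) = ≤-refl
  inside≤1 (no _)  = z≤n

  incidence≤1 : ∀ {e} (d : Dec (Copied e)) v → incidence d v ≤ 1
  incidence≤1 {e} (yes (i , j , copy)) v = δ+δ≤1 (toℕ v) (copy-irrefl copy)
  incidence≤1 (no _)                   v = z≤n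

  ∑-incidence : ∀ {e} (d : Dec (Copied e)) → ∑[ v < p ] incidence d v ≡ 2 * inside d
  ∑-incidence (yes (i , j , _)) = trans
    (∑-distrib-+ {p} (λ v → δ (toℕ i) (toℕ v)) (λ v → δ (toℕ j) (toℕ v)))
    (cong₂ _+_ (sum-δ (toℕ<n i)) (sum-δ (toℕ<n j)))
  ∑-incidence (no _) = sum-zero {p} (λ _ → refl)

  ∑-link : ∀ {e} (d : Dec (Copied e)) u → ∑[ v < p ] link d u v ≡ incidence d u
  ∑-link (no _)            u = sum-zero {p} (λ _ → refl)
  ∑-link (yes (i , j , _)) u = trans
    (∑-distrib-+ {p} (λ v → δ (toℕ i) (toℕ u) * δ (toℕ j) (toℕ v)) (λ v → δ (toℕ j) (toℕ u) * δ (toℕ i) (toℕ v)))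
    (cong₂ _+_ (pull (δ (toℕ i) (toℕ u)) j) (pull (δ (toℕ j) (toℕ u)) i))
    where
    pull : ∀ c j → ∑[ v < p ] (c * δ (toℕ j) (toℕ v)) ≡ c
    pull c j = trans (sym (*-distribˡ-sum {p} c (λ v → δ (toℕ j) (toℕ v))))
      (trans (cong (c *_) (sum-δ (toℕ<n j))) (*-identityʳ c))

  incident⇒end : ∀ {e} (d : Dec (Copied e)) {v} → 1 ≤ incidence d v → f v ≡ src e ⊎ f v ≡ tgt e
  incident⇒end (yes (i , j , is-copy fi fj _)) {v} 1≤ with 1≤m+n⇒1≤m⊎1≤n (δ (toℕ i) (toℕ v)) 1≤
  ... | inj₁ 1≤i = inj₁ (trans (cong f (sym (1≤δ-toℕ⇒≡ i v 1≤i))) fi)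
  ... | inj₂ 1≤j = inj₂ (trans (cong f (sym (1≤δ-toℕ⇒≡ j v 1≤j))) fj)

  δδ⇒≡ : ∀ {i j u v : Fin p} → 1 ≤ δ (toℕ i) (toℕ u) * δ (toℕ j) (toℕ v) → i ≡ u × j ≡ v
  δδ⇒≡ {i} {j} {u} {v} 1≤ with 1≤m*n⇒1≤m×1≤n (δ (toℕ i) (toℕ u)) _ 1≤
  ... | 1≤i , 1≤j = 1≤δ-toℕ⇒≡ i u 1≤i , 1≤δ-toℕ⇒≡ j v 1≤j

  link⇒joins : ∀ {e} (d : Dec (Copied e)) {u v} → 1 ≤ link d u v → Joins e u v
  link⇒joins (yes (i , j , copy)) {u} {v} 1≤ with 1≤m+n⇒1≤m⊎1≤n (δ (toℕ i) (toℕ u) * δ (toℕ j) (toℕ v)) 1≤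
  ... | inj₁ 1≤ij with δδ⇒≡ {i} {j} 1≤ij
  ...   | refl , refl = inj₁ copy
  link⇒joins (yes (i , j , copy)) {u} {v} 1≤ | inj₂ 1≤ji with δδ⇒≡ {j} {i} 1≤ji
  ...   | refl , refl = inj₂ copy

  joins⇒link : ∀ {e} (d : Dec (Copied e)) {u v} → Joins e u v → 1 ≤ link d u v
  joins⇒link (no ¬copied) (inj₁ copy) = ⊥-elim (¬copied (_ , _ , copy))
  joins⇒link (no ¬copied) (inj₂ copy) = ⊥-elim (¬copied (_ , _ , copy))
  joins⇒link (yes (i , j , is-copy fi fj _)) {u} {v} (inj₁ (is-copy fu fv _))
    with f-injective (trans fi (sym fu)) | f-injective (trans fj (sym fv))
  ... | refl | refl rewrite δ-refl (toℕ u) | δ-refl (toℕ v) = s≤s z≤n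
  joins⇒link (yes (i , j , is-copy fi fj _)) {u} {v} (inj₂ (is-copy fv fu _))
    with f-injective (trans fi (sym fv)) | f-injective (trans fj (sym fu))
  ... | refl | refl rewrite δ-refl (toℕ u) | δ-refl (toℕ v) = m≤n+m 1 _

  link≤1 : ∀ {e} (d : Dec (Copied e)) u v → link d u v ≤ 1
  link≤1 d u v = ≤-trans (term≤sum (link d u) v)
    (≤-trans (≤-reflexive (∑-link d u)) (incidence≤1 d u))

  incident-both⇒joins : ∀ {e} (d : Dec (Copied e)) {u v} → u ≢ v →
    1 ≤ incidence d u → 1 ≤ incidence d v → Joins e u v
  incident-both⇒joins (yes (i , j , copy)) {u} {v} u≢v 1≤u 1≤v
    with 1≤m+n⇒1≤m⊎1≤n (δ (toℕ i) (toℕ u)) 1≤u | 1≤m+n⇒1≤m⊎1≤n (δ (toℕ i) (toℕ v)) 1≤v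
  ... | inj₁ iu | inj₁ iv = ⊥-elim (u≢v (trans (sym (1≤δ-toℕ⇒≡ i u iu)) (1≤δ-toℕ⇒≡ i v iv)))
  ... | inj₂ ju | inj₂ jv = ⊥-elim (u≢v (trans (sym (1≤δ-toℕ⇒≡ j u ju)) (1≤δ-toℕ⇒≡ j v jv)))
  ... | inj₁ iu | inj₂ jv with 1≤δ-toℕ⇒≡ i u iu | 1≤δ-toℕ⇒≡ j v jv
  ...   | refl | refl = inj₁ copy
  incident-both⇒joins (yes (i , j , copy)) {u} {v} u≢v 1≤u 1≤v
    | inj₂ ju | inj₁ iv with 1≤δ-toℕ⇒≡ j u ju | 1≤δ-toℕ⇒≡ i v iv
  ...   | refl | refl = inj₂ copy

  -- The two distinct ends of the first edge are also met by the second, so both edges join the same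
  -- pair of vertices.
  same-incidence⇒≡ : ∀ {e e′} (d : Dec (Copied e)) (d′ : Dec (Copied e′)) → 1 ≤ inside d →
    (∀ v → incidence d v ≡ incidence d′ v) → e ≡ e′
  same-incidence⇒≡ {e} (yes (i , j , copy)) d′ _ same = joins-unique (inj₁ copy)
    (incident-both⇒joins d′ (copy-irrefl copy ∘ cong toℕ) (meets′ i (≤-trans (≤-reflexive (sym (δ-refl (toℕ i)))) (m≤m+n _ _)))
      (meets′ j (≤-trans (≤-reflexive (sym (δ-refl (toℕ j)))) (m≤n+m _ (δ (toℕ i) (toℕ j))))))
    where
    meets′ : ∀ v → 1 ≤ δ (toℕ i) (toℕ v) + δ (toℕ j) (toℕ v) → 1 ≤ incidence d′ v
    meets′ v = subst (1 ≤_) (same v)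

  edgeOf : ∀ u v → adj P u v ≡ true → ∃ λ e → Joins e u v
  edgeOf u v uv with Fin.<-cmp (f u) (f v)
  ... | tri< fu<fv _ _ = edge (f u) (f v) fu<fv (hom u v uv) , inj₁ (is-copy refl refl uv)
  ... | tri> _ _ fv<fu = edge (f v) (f u) fv<fu (hom v u vu) , inj₂ (is-copy refl refl vu)
    where
    vu : adj P v u ≡ true
    vu = trans (Graph.sym P v u) uv
  ... | tri≈ _ fu≡fv _ with f-injective fu≡fv
  ...   | refl with trans (sym uv) (irrefl P u)
  ...     | ()

  shared : ∀ (e e′ : Edge H) {y} → y ≡ src e ⊎ y ≡ tgt e → y ≡ src e′ ⊎ y ≡ tgt e′ → ShareVertex e e′
  shared _ _ (inj₁ ys) (inj₁ ys′) = inj₁ (trans (sym ys) ys′)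
  shared _ _ (inj₁ ys) (inj₂ yt′) = inj₂ (inj₁ (trans (sym ys) yt′))
  shared _ _ (inj₂ yt) (inj₁ ys′) = inj₂ (inj₂ (inj₁ (trans (sym yt) ys′)))
  shared _ _ (inj₂ yt) (inj₂ yt′) = inj₂ (inj₂ (inj₂ (trans (sym yt) yt′)))

  -- Since d < m the two edges are distinct; a common vertex would make them adjacent at cyclic
  -- distance at most d < s.
  nearby-disjoint : ∀ x {d v} → 0 < d → d < s →
    1 ≤ incidence (copied? (edgeAt x)) v → ¬ 1 ≤ incidence (copied? (edgeAt (x + d))) v
  nearby-disjoint x {d} {v} 0<d d<s 1≤x 1≤y = <⇒≱ d<s (begin
    s                                                       ≤⟨ separated (edgeAt x) (edgeAt (x + d))
                                                                 (edgeAt-distinct x 0<d d<m ,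
                                                                  shared (edgeAt x) (edgeAt (x + d)) (incident⇒end (copied? (edgeAt x)) 1≤x)
                                                                         (incident⇒end (copied? (edgeAt (x + d))) 1≤y)) ⟩
    cycDist (to (edgeAt x)) (to (edgeAt (x + d)))           ≤⟨ m⊓n≤m (fwdDist (to (edgeAt x)) (to (edgeAt (x + d)))) (fwdDist (to (edgeAt (x + d))) (to (edgeAt x))) ⟩
    fwdDist (to (edgeAt x)) (to (edgeAt (x + d)))           ≡⟨ cong₂ fwdDist (to-edgeAt x) (to-edgeAt (x + d)) ⟩
    fwdDist (x mod m) ((x + d) mod m)                       ≤⟨ fwdDist≤ 0<d d<m (mod-ahead x m′ d<m) ⟩
    d                                                       ∎)
    where
    d<m : d < m
    d<m = ≤-trans d<s s≤m

  cyclicPattern : CyclicPattern p m s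
  cyclicPattern = record
    { a          = λ x → inside (copied? (edgeAt x))
    ; b          = λ v x → incidence (copied? (edgeAt x)) v
    ; a≤1        = λ x → inside≤1 (copied? (edgeAt x))
    ; a-periodic = λ x → cong (λ e → inside (copied? e)) (edgeAt-periodic x)
    ; b-periodic = λ v x → cong (λ e → incidence (copied? e) v) (edgeAt-periodic x)
    ; handshake  = λ x → ∑-incidence (copied? (edgeAt x))
    ; matching   = λ v x → sum≤1 {s} _ (λ i → incidence≤1 (copied? (edgeAt (x + toℕ i))) v) (far v x)
    ; separating = λ x d 1≤a same → ≮⇒≥ λ d<m → edgeAt-distinct x (s≤s z≤n) d<m
                     (same-incidence⇒≡ (copied? (edgeAt x)) (copied? (edgeAt (x + suc d))) 1≤a same)
    }
    where
    far : ∀ v x (i j : Fin s) → toℕ i < toℕ j →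
      1 ≤ incidence (copied? (edgeAt (x + toℕ i))) v → ¬ 1 ≤ incidence (copied? (edgeAt (x + toℕ j))) v
    far v x i j i<j 1≤i 1≤j with m≤n⇒∃[o]m+o≡n i<j
    ... | o , 1+i+o≡j = nearby-disjoint (x + toℕ i) {suc o} (s≤s z≤n)
      (≤-trans (s≤s (≤-trans (m≤n+m (suc o) (toℕ i)) (≤-reflexive (trans (+-suc (toℕ i) o) 1+i+o≡j)))) (toℕ<n j))
      1≤i
      (subst (λ y → 1 ≤ incidence (copied? (edgeAt y)) v)
        (trans (cong (x +_) (trans (sym 1+i+o≡j) (sym (+-suc (toℕ i) o)))) (sym (+-assoc x (toℕ i) (suc o))))
        1≤j)

  open CyclicPattern cyclicPattern using (size; deg; handshake-window)

  -- An edge of P has an image in H, whose position is given by `ℓ`; a second position in the same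
  -- period would hold a different edge with the same ends.
  ∑-link-positions : ∀ u v → ∑[ x < m ] link (copied? (edgeAt (toℕ x))) u v ≡ bit (adj P u v)
  ∑-link-positions u v with adj P u v in uv
  ... | false = sum-zero {m} λ x → n<1⇒n≡0 (≰⇒> λ 1≤ → nonadjacent (link⇒joins (copied? (edgeAt (toℕ x))) 1≤))
    where
    nonadjacent : ∀ {e} → ¬ Joins e u v
    nonadjacent (inj₁ (is-copy _ _ uv′)) with trans (sym uv) uv′
    ... | ()
    nonadjacent (inj₂ (is-copy _ _ vu′)) with trans (sym uv) (trans (Graph.sym P u v) vu′)
    ... | ()
  ... | true = ≤-antisym
    (sum≤1 {m} _ (λ x → link≤1 (copied? (edgeAt (toℕ x))) u v) unique)
    (≤-trans 1≤link (term≤sum (λ x → link (copied? (edgeAt (toℕ x))) u v) (to e)))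
    where
    e : Edge H
    e = proj₁ (edgeOf u v uv)
    1≤link : 1 ≤ link (copied? (edgeAt (toℕ (to e)))) u v
    1≤link = joins⇒link (copied? (edgeAt (toℕ (to e))))
      (subst (λ e′ → Joins e′ u v) (sym (edgeAt-to e)) (proj₂ (edgeOf u v uv)))
    unique : ∀ (x y : Fin m) → toℕ x < toℕ y →
      1 ≤ link (copied? (edgeAt (toℕ x))) u v → ¬ 1 ≤ link (copied? (edgeAt (toℕ y))) u v
    unique x y x<y 1≤x 1≤y with m≤n⇒∃[o]m+o≡n x<y
    ... | o , 1+x+o≡y = edgeAt-distinct (toℕ x) {suc o} (s≤s z≤n)
      (≤-trans (s≤s (≤-trans (m≤n+m (suc o) (toℕ x)) (≤-reflexive x+1+o≡y))) (toℕ<n y))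
      (trans (joins-unique (link⇒joins (copied? (edgeAt (toℕ x))) 1≤x) (link⇒joins (copied? (edgeAt (toℕ y))) 1≤y))
             (cong edgeAt (sym x+1+o≡y)))
      where
      x+1+o≡y : toℕ x + suc o ≡ toℕ y
      x+1+o≡y = trans (+-suc (toℕ x) o) 1+x+o≡y

  -- Double counting of the pairs of a position and a neighbour of `v` that its edge joins to `v`.
  deg≡degree : ∀ v → deg v ≡ degree P v
  deg≡degree v = begin-equality
    ∑[ x < m ] incidence (copied? (edgeAt (toℕ x))) v                ≡⟨ sum-cong-≗ {m} (λ x → sym (∑-link (copied? (edgeAt (toℕ x))) v)) ⟩
    ∑[ x < m ] ∑[ j < p ] link (copied? (edgeAt (toℕ x))) v j        ≡⟨ ∑-comm {m} {p} (λ x j → link (copied? (edgeAt (toℕ x))) v j) ⟩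
    ∑[ j < p ] ∑[ x < m ] link (copied? (edgeAt (toℕ x))) v j        ≡⟨ sum-cong-≗ {p} (∑-link-positions v) ⟩
    ∑[ j < p ] bit (adj P v j)                                       ≡⟨ sym (degree-sum P v) ⟩
    degree P v                                                       ∎

  2*size≡∑degree : 2 * size ≡ ∑[ v < p ] degree P v
  2*size≡∑degree = trans (sym (handshake-window 0 m)) (sum-cong-≗ {p} deg≡degree)

-- Bounds on cms from the degrees of a subgraph

cms-bound-regular : ∀ {p n} {P : Graph p} {H : Graph n} t → p ≡ suc (2 * t) → 1 ≤ t →
  Regular (2 * t) P → SubgraphOf P H → CmsAtMostFrac H (2 * t + 1)
cms-bound-regular {P = P} {H} t refl 1≤t regular (f , f-injective , hom) (suc m′) ℓ (suc s′) 1≤s s≤m separated =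
  -- The degree sum gives exactly (2t + 1) t edges, whereas `size<ct` with k = 2t requires strictly
  -- fewer.
  ≮⇒≥ λ m<cs → <⇒≢ (Tight.size<ct t (2 * t) cyclicPattern s≤m (subst (λ c → suc m′ < c * suc s′) (+-comm (2 * t) 1) m<cs) 1≤size) size≡
  where
  open OrderedCopy P H f f-injective hom ℓ s≤m separated
  open CyclicPattern cyclicPattern using (size)
  factor : ∀ t → suc (2 * t) * (2 * t) ≡ 2 * (suc (2 * t) * t)
  factor = solve-∀
  size≡ : size ≡ suc (2 * t) * t
  size≡ = *-cancelˡ-≡ size _ 2 (begin-equality
    2 * size                              ≡⟨ 2*size≡∑degree ⟩
    ∑[ v < suc (2 * t) ] degree P v       ≡⟨ sum-cong-≗ {suc (2 * t)} regular ⟩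
    ∑[ v < suc (2 * t) ] (2 * t)          ≡⟨ sum-const (suc (2 * t)) (2 * t) ⟩
    suc (2 * t) * (2 * t)                 ≡⟨ factor t ⟩
    2 * (suc (2 * t) * t)                 ∎)
  1≤size : 1 ≤ size
  1≤size = ≤-trans 1≤t (≤-trans (m≤m+n t _) (≤-reflexive (sym size≡)))

-- Here k = 2u + 1 and t = u + 1. The degree sum is (2t + 1) k - 1, so |E(P)| + 1 = (k + 1) t, which
-- is the tightness that `Gap` requires. As `w` has degree 2u, the gap bound falls short of |E(P)|
-- by one.
cms-bound-deficient : ∀ {p n} {P : Graph p} {H : Graph n} u → p ≡ suc (2 * suc u) → 1 ≤ u →
  (w : Fin p) → (∀ v → degree P v + δ (toℕ w) (toℕ v) ≡ suc (2 * u)) →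
  SubgraphOf P H → CmsAtMostFrac H (suc (2 * u) + 1)
cms-bound-deficient {P = P} {H} u refl 1≤u w degree≡ (f , f-injective , hom) (suc m′) ℓ (suc s′) 1≤s s≤m separated =
  ≮⇒≥ λ m<cs → <-irrefl refl (begin-strict
    size                   ≤⟨ Tight.Gap.size≤[1+t]deg (suc u) (suc (2 * u)) cyclicPattern s≤m
                                (subst (λ c → suc m′ < c * suc s′) (+-comm (suc (2 * u)) 1) m<cs)
                                (≤-reflexive (sym 1+size≡)) t<size w ⟩
    suc (suc u) * deg w    ≡⟨ cong (suc (suc u) *_) deg-w ⟩
    suc (suc u) * (2 * u)  <⟨ n<1+n _ ⟩
    suc (suc (suc u) * (2 * u)) ≡⟨ suc-injective (trans (factor′ u) (sym 1+size≡)) ⟩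
    size                   ∎)
  where
  open OrderedCopy P H f f-injective hom ℓ s≤m separated
  open CyclicPattern cyclicPattern using (size; deg)
  t p : ℕ
  t = suc u
  p = suc (2 * t)
  factor : ∀ u → suc (suc (2 * suc u) * suc (2 * u)) ≡ 2 * (suc (suc (2 * u)) * suc u)
  factor = solve-∀
  factor′ : ∀ u → suc (suc (suc (suc u) * (2 * u))) ≡ suc (suc (2 * u)) * suc u
  factor′ = solve-∀
  1+size≡ : suc size ≡ suc (suc (2 * u)) * t
  1+size≡ = *-cancelˡ-≡ (suc size) _ 2 (begin-equality
    2 * suc size                                              ≡⟨ *-suc 2 size ⟩
    suc (suc (2 * size))                                      ≡⟨ cong suc (+-comm 1 (2 * size)) ⟩
    suc (2 * size + 1)                                        ≡⟨ cong suc (cong₂ _+_ (2*size≡∑degree) (sym (sum-δ (toℕ<n w)))) ⟩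
    suc (∑[ v < p ] degree P v + ∑[ v < p ] δ (toℕ w) (toℕ v)) ≡⟨ cong suc (sym (∑-distrib-+ {p} (degree P) (λ v → δ (toℕ w) (toℕ v)))) ⟩
    suc (∑[ v < p ] (degree P v + δ (toℕ w) (toℕ v)))         ≡⟨ cong suc (sum-cong-≗ {p} degree≡) ⟩
    suc (∑[ v < p ] suc (2 * u))                              ≡⟨ cong suc (sum-const p (suc (2 * u))) ⟩
    suc (p * suc (2 * u))                                     ≡⟨ factor u ⟩
    2 * (suc (suc (2 * u)) * t)                               ∎)
  deg-w : deg w ≡ 2 * u
  deg-w = suc-injective (begin-equality
    suc (deg w)                         ≡⟨ +-comm 1 (deg w) ⟩
    deg w + 1                           ≡⟨ cong₂ _+_ (deg≡degree w) (sym (δ-refl (toℕ w))) ⟩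
    degree P w + δ (toℕ w) (toℕ w)      ≡⟨ degree≡ w ⟩
    suc (2 * u)                         ∎)
  -- The number of edges exceeds t by 3u + 2u², which is positive because `1 ≤ u`.
  split : ∀ u → suc (suc (2 * u)) * suc u ≡ suc (suc u + (3 * u + 2 * u * u))
  split = solve-∀
  t<size : t < size
  t<size = subst (t <_) (suc-injective (trans (sym (split u)) (sym 1+size≡)))
    (m<m+n t (≤-trans 1≤u (≤-trans (m≤m+n u _) (m≤m+n (3 * u) _))))

-- Degrees in B k

even⇒2* : ∀ k → isEven k ≡ true → ∃ λ t → k ≡ 2 * t
odd⇒1+2* : ∀ k → isEven k ≡ false → ∃ λ u → k ≡ suc (2 * u)
even⇒2* zero    _ = 0 , refl
even⇒2* (suc k) e with odd⇒1+2* k (Bool.not-injective e)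
... | u , refl = suc u , sym (*-suc 2 u)
odd⇒1+2* (suc k) o with even⇒2* k (Bool.not-injective o)
... | t , refl = t , refl

module _ {k} (k-even : isEven k ≡ true) where

  bSize-even : bSize k ≡ suc k
  bSize-even = cong (λ b → if b then suc k else suc (suc k)) k-even

  B-regular : Regular k (B k)
  B-regular v = +-cancelʳ-≡ 1 _ _ (begin-equality
    degree (B k) v + 1
      ≡⟨ cong₂ _+_ (degree-sum (B k) v) (sym (sum-δ (toℕ<n v))) ⟩
    ∑[ j < bSize k ] bit (adjBℕ k (toℕ v) (toℕ j)) + ∑[ j < bSize k ] δ (toℕ v) (toℕ j)
      ≡⟨ sym (∑-distrib-+ {bSize k} (λ j → bit (adjBℕ k (toℕ v) (toℕ j))) (λ j → δ (toℕ v) (toℕ j))) ⟩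
    ∑[ j < bSize k ] (bit (adjBℕ k (toℕ v) (toℕ j)) + δ (toℕ v) (toℕ j))
      ≡⟨ sum-ones {bSize k} (λ j → complete (toℕ v) (toℕ j)) ⟩
    bSize k ≡⟨ bSize-even ⟩
    suc k   ≡⟨ +-comm 1 k ⟩
    k + 1   ∎)
    where
    complete : ∀ a b → bit (adjBℕ k a b) + δ a b ≡ 1
    complete a b rewrite k-even with a ≡ᵇ b
    ... | true  = refl
    ... | false = refl

module _ {k} (k-odd : isEven k ≡ false) where

  bSize-odd : bSize k ≡ suc (suc k)
  bSize-odd = cong (λ b → if b then suc k else suc (suc k)) k-odd

  private
    <bSize : ∀ {a} → a < suc (suc k) → a < bSize k
    <bSize = subst (_ <_) (sym bSize-odd)

  a≡ᵇ1+a : ∀ a → (a ≡ᵇ suc a) ≡ false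
  a≡ᵇ1+a a = ≡ᵇ-false (<⇒≢ (n<1+n a))

  compl-irrefl : ∀ a → compl a a ≡ false
  compl-irrefl zero = refl
  compl-irrefl (suc a) rewrite a≡ᵇ1+a a | Bool.∧-zeroʳ (not (isEven (suc a))) = refl

  compl-0 : ∀ j → compl 0 j ≡ (1 ≡ᵇ j)
  compl-0 zero          = refl
  compl-0 (suc zero)    = refl
  compl-0 (suc (suc j)) = Bool.∧-zeroʳ (not (isEven (suc (suc j))))

  compl-1 : ∀ j → bit (compl 1 j) ≡ δ 0 j + δ 2 j
  compl-1 zero                = refl
  compl-1 (suc zero)          = refl
  compl-1 (suc (suc zero))    = refl
  compl-1 (suc (suc (suc j))) = cong bit (Bool.∧-zeroʳ (not (isEven (suc (suc (suc j))))))

  -- An even vertex from 2 on is the larger end of its only complement edge; for vertex 2 this is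
  -- the second edge of the path.
  compl-even : ∀ {a} → isEven a ≡ true → ∀ j → compl (suc (suc a)) j ≡ (suc a ≡ᵇ j)
  compl-even {a} a-even j rewrite a-even | Bool.∧-zeroʳ (j ≡ᵇ 0) with suc a ≟ j
  ... | yes refl rewrite a-even | ≡ᵇ-refl a = refl
  ... | no  a≢j  rewrite ≡ᵇ-false a≢j = Bool.∧-zeroʳ (not (isEven j))

  compl-odd : ∀ {a} → isEven a ≡ false → ∀ j → compl (suc (suc a)) j ≡ (suc (suc (suc a)) ≡ᵇ j)
  compl-odd {a} a-odd j rewrite a-odd | Bool.∧-zeroʳ (j ≡ᵇ 0) =
    trans (cong ((j ≡ᵇ 3 + a) ∨_) absent) (trans (Bool.∨-identityʳ _) (≡ᵇ-sym j (3 + a)))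
    where
    absent : not (isEven j) ∧ (suc a ≡ᵇ j) ≡ false
    absent with suc a ≟ j
    ... | yes refl rewrite a-odd = refl
    ... | no  a≢j  rewrite ≡ᵇ-false a≢j = Bool.∧-zeroʳ (not (isEven j))

  -- Vertex 1 is the middle of the complementary path, hence has two non-neighbours.
  ∑-compl : ∀ a → a < bSize k → ∑[ j < bSize k ] bit (compl a (toℕ j)) ≡ 1 + δ 1 a
  ∑-compl zero a<p = trans (sum-cong-≗ {bSize k} (λ j → cong bit (compl-0 (toℕ j)))) (sum-δ (<bSize (s≤s (s≤s z≤n))))
  ∑-compl (suc zero) a<p = begin-equality
    ∑[ j < bSize k ] bit (compl 1 (toℕ j))                            ≡⟨ sum-cong-≗ {bSize k} (λ j → compl-1 (toℕ j)) ⟩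
    ∑[ j < bSize k ] (δ 0 (toℕ j) + δ 2 (toℕ j))                      ≡⟨ ∑-distrib-+ {bSize k} (λ j → δ 0 (toℕ j)) (λ j → δ 2 (toℕ j)) ⟩
    ∑[ j < bSize k ] δ 0 (toℕ j) + ∑[ j < bSize k ] δ 2 (toℕ j)       ≡⟨ cong₂ _+_ (sum-δ (<bSize (s≤s z≤n))) (sum-δ (<bSize (s≤s (s≤s (1≤odd k-odd))))) ⟩
    2                                                                 ∎
    where
    1≤odd : ∀ {k} → isEven k ≡ false → 1 ≤ k
    1≤odd {suc k} _ = s≤s z≤n
  ∑-compl (suc (suc a)) a<p with isEven a Bool.≟ true
  ... | yes a-even = trans (sum-cong-≗ {bSize k} (λ j → cong bit (compl-even a-even (toℕ j)))) (sum-δ (<-trans (n<1+n _) a<p))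
  -- The last vertex k + 1 is even, so the odd vertex a + 2 is smaller and its partner a + 3 is
  -- still a vertex.
  ... | no ¬a-even = trans (sum-cong-≗ {bSize k} (λ j → cong bit (compl-odd a-odd (toℕ j)))) (sum-δ (<bSize
    (s≤s (≤∧≢⇒< (≤-pred (subst (suc (suc a) <_) bSize-odd a<p)) λ a≡k →
      contradiction (trans (cong isEven a≡k) (cong not k-odd)) parity-mismatch))))
    where
    a-odd : isEven a ≡ false
    a-odd = Bool.¬-not ¬a-even
    parity-mismatch : isEven (suc (suc a)) ≢ true
    parity-mismatch rewrite a-odd = λ ()

  -- Each of the k + 2 vertices is a neighbour of `v`, `v` itself or a neighbour of `v` in the
  -- complement; the last kind is counted by `∑-compl`.
  B-deficient : ∀ v → degree (B k) v + δ 1 (toℕ v) ≡ k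
  B-deficient v = +-cancelˡ-≡ 2 _ _ (begin-equality
    2 + (degree (B k) v + δ 1 (toℕ v))
      ≡⟨ regroup (degree (B k) v) (δ 1 (toℕ v)) ⟩
    degree (B k) v + (1 + (1 + δ 1 (toℕ v)))
      ≡⟨ cong₂ _+_ (degree-sum (B k) v) (sym (cong₂ _+_ (sum-δ (toℕ<n v)) (∑-compl (toℕ v) (toℕ<n v)))) ⟩
    ∑[ j < bSize k ] bit (adjBℕ k (toℕ v) (toℕ j)) + (∑[ j < bSize k ] δ (toℕ v) (toℕ j) + ∑[ j < bSize k ] bit (compl (toℕ v) (toℕ j)))
      ≡⟨ cong (∑[ j < bSize k ] bit (adjBℕ k (toℕ v) (toℕ j)) +_) (sym (∑-distrib-+ {bSize k} (λ j → δ (toℕ v) (toℕ j)) (λ j → bit (compl (toℕ v) (toℕ j))))) ⟩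
    ∑[ j < bSize k ] bit (adjBℕ k (toℕ v) (toℕ j)) + ∑[ j < bSize k ] (δ (toℕ v) (toℕ j) + bit (compl (toℕ v) (toℕ j)))
      ≡⟨ sym (∑-distrib-+ {bSize k} (λ j → bit (adjBℕ k (toℕ v) (toℕ j))) (λ j → δ (toℕ v) (toℕ j) + bit (compl (toℕ v) (toℕ j)))) ⟩
    ∑[ j < bSize k ] (bit (adjBℕ k (toℕ v) (toℕ j)) + (δ (toℕ v) (toℕ j) + bit (compl (toℕ v) (toℕ j))))
      ≡⟨ sum-ones {bSize k} (λ j → trichotomy (toℕ v) (toℕ j)) ⟩
    bSize k
      ≡⟨ bSize-odd ⟩
    2 + k   ∎)
    where
    regroup : ∀ x y → 2 + (x + y) ≡ x + (1 + (1 + y))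
    regroup = solve-∀
    trichotomy : ∀ a b → bit (adjBℕ k a b) + (δ a b + bit (compl a b)) ≡ 1
    trichotomy a b rewrite k-odd with a ≡ᵇ b in eq
    ... | true rewrite sym (≡ᵇ⇒≡ a b (subst T (sym eq) _)) | compl-irrefl a = refl
    ... | false with compl a b
    ...   | true  = refl
    ...   | false = refl

-- Regular graphs containing B k

sum-↑ : ∀ p {q} (F : Fin (p + q) → ℕ) → sum F ≡ ∑[ i < p ] F (i ↑ˡ q) + ∑[ j < q ] F (p ↑ʳ j)
sum-↑ zero    F = refl
sum-↑ (suc p) F = trans (cong (F zero +_) (sum-↑ p (F ∘ suc))) (sym (+-assoc (F zero) _ _))

module _ {p q} (G : Graph p) (G′ : Graph q) (bridge : Fin p → Fin q → Bool) where

  joinAdj : Fin p ⊎ Fin q → Fin p ⊎ Fin q → Bool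
  joinAdj (inj₁ a) (inj₁ a′) = adj G a a′
  joinAdj (inj₁ a) (inj₂ b)  = bridge a b
  joinAdj (inj₂ b) (inj₁ a)  = bridge a b
  joinAdj (inj₂ b) (inj₂ b′) = adj G′ b b′

  joinAdj-sym : ∀ x y → joinAdj x y ≡ joinAdj y x
  joinAdj-sym (inj₁ a) (inj₁ a′) = Graph.sym G a a′
  joinAdj-sym (inj₁ a) (inj₂ b)  = refl
  joinAdj-sym (inj₂ b) (inj₁ a)  = refl
  joinAdj-sym (inj₂ b) (inj₂ b′) = Graph.sym G′ b b′

  joinAdj-irrefl : ∀ x → joinAdj x x ≡ false
  joinAdj-irrefl (inj₁ a) = irrefl G a
  joinAdj-irrefl (inj₂ b) = irrefl G′ b

  bridged : Graph (p + q)
  bridged = record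
    { adj    = λ u v → joinAdj (splitAt p u) (splitAt p v)
    ; sym    = λ u v → joinAdj-sym (splitAt p u) (splitAt p v)
    ; irrefl = λ u → joinAdj-irrefl (splitAt p u)
    }

  bridged-regular : ∀ {k} →
    (∀ a → degree G a + ∑[ b < q ] bit (bridge a b) ≡ k) →
    (∀ b → ∑[ a < p ] bit (bridge a b) + degree G′ b ≡ k) →
    Regular k bridged
  bridged-regular {k} left right v = trans (degree-sum bridged v) (trans (split (splitAt p v)) (regular (splitAt p v)))
    where
    total : Fin p ⊎ Fin q → ℕ
    total x = ∑[ a < p ] bit (joinAdj x (inj₁ a)) + ∑[ b < q ] bit (joinAdj x (inj₂ b))
    split : ∀ x → ∑[ w < p + q ] bit (joinAdj x (splitAt p w)) ≡ total x
    split x = trans (sum-↑ p (λ w → bit (joinAdj x (splitAt p w)))) (cong₂ _+_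
      (sum-cong-≗ {p} (λ a → cong (λ y → bit (joinAdj x y)) (splitAt-↑ˡ p a q)))
      (sum-cong-≗ {q} (λ b → cong (λ y → bit (joinAdj x y)) (splitAt-↑ʳ p q b))))
    regular : ∀ x → total x ≡ k
    regular (inj₁ a) = trans (cong (_+ _) (sym (degree-sum G a))) (left a)
    regular (inj₂ b) = trans (cong (∑[ a < p ] bit (bridge a b) +_) (sym (degree-sum G′ b))) (right b)

  ⊆bridged : SubgraphOf G bridged
  ⊆bridged = (_↑ˡ q) , ↑ˡ-injective q _ _ , λ u v uv →
    trans (cong₂ joinAdj (splitAt-↑ˡ p u q) (splitAt-↑ˡ p v q)) uv

-- Circulant graphs

within : ℕ → ℕ → Bool
-- Distance 0 is excluded, so that the circulant has no loops.
within r zero    = false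
within r (suc c) = c <ᵇ r

within-true : ∀ {r c} → 1 ≤ c → c ≤ r → within r c ≡ true
within-true {r} {suc c} _ c<r with c <ᵇ r in eq
... | true  = refl
... | false = ⊥-elim (subst T eq (<⇒<ᵇ c<r))

within-false : ∀ {r c} → r < c → within r c ≡ false
within-false {r} {suc c} (s≤s r≤c) with c <ᵇ r in eq
... | false = refl
... | true  = ⊥-elim (<⇒≱ (<ᵇ⇒< c r (subst T (sym eq) _)) r≤c)

-- The vertices of the circulant at difference d are at cyclic distance d ⊓ (N ∸ d).
circular : ℕ → ℕ → ℕ → Bool
circular N r d = within r (d ⊓ (N ∸ d))

circular-reflect : ∀ {N} r {d} → d ≤ N → circular N r (N ∸ d) ≡ circular N r d
circular-reflect {N} r {d} d≤N = cong (within r)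
  (trans (cong ((N ∸ d) ⊓_) (m∸[m∸n]≡n d≤N)) (⊓-comm (N ∸ d) d))

-- The row of `suc i` is the row of `i` shifted by one: its new first entry `g (suc i)` equals, by
-- reflection, the entry that drops out at the end.
rotate : ∀ {N} (g : ℕ → ℕ) → (∀ {d} → d ≤ N → g (N ∸ d) ≡ g d) →
  ∀ i → i < N → ∑[ j < N ] g ∣ i - toℕ j ∣ ≡ ∑[ j < N ] g (toℕ j)
rotate g reflect zero    _ = refl
rotate {suc N} g reflect (suc i) (s≤s i<N) = begin-equality
  g (suc i) + ∑[ j < N ] g ∣ i - toℕ j ∣       ≡⟨ +-comm (g (suc i)) _ ⟩
  ∑[ j < N ] g ∣ i - toℕ j ∣ + g (suc i)       ≡⟨ cong (∑[ j < N ] g ∣ i - toℕ j ∣ +_) (sym (trans (cong g (m≤n⇒∣m-n∣≡n∸m (<⇒≤ i<N))) (reflect (s≤s (<⇒≤ i<N))))) ⟩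
  ∑[ j < N ] g ∣ i - toℕ j ∣ + g ∣ i - N ∣     ≡⟨ sym (window-snoc (λ j → g ∣ i - j ∣) 0 N) ⟩
  ∑[ j < suc N ] g ∣ i - toℕ j ∣               ≡⟨ rotate g reflect i (m<n⇒m<1+n i<N) ⟩
  ∑[ j < suc N ] g (toℕ j)                     ∎

-- The differences fall into 0, then r near ones, c = N - 1 - 2r far ones, and r near ones from the
-- other side.
∑-circular : ∀ {N} r → 2 * r < N → ∑[ j < N ] bit (circular N r (toℕ j)) ≡ 2 * r
∑-circular r 2r<N with m≤n⇒∃[o]m+o≡n 2r<N
... | c , refl = begin-equality
  window g 0 N                                                 ≡⟨ cong (window g 0) (N≡ r c) ⟩
  window g 0 (1 + (r + (c + r)))                               ≡⟨ window-cons g 0 (r + (c + r)) ⟩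
  window g 1 (r + (c + r))                                     ≡⟨ window-++ g 1 r (c + r) ⟩
  window g 1 r + window g (1 + r) (c + r)                      ≡⟨ cong (window g 1 r +_) (window-++ g (1 + r) c r) ⟩
  window g 1 r + (window g (1 + r) c + window g (1 + r + c) r) ≡⟨ cong₂ _+_ (sum-ones {r} low) (cong₂ _+_ (sum-zero {c} middle) (sum-ones {r} high)) ⟩
  r + r                                                        ≡⟨ cong (r +_) (sym (+-identityʳ r)) ⟩
  2 * r                                                        ∎
  where
  N : ℕ
  N = suc (2 * r + c)
  g : ℕ → ℕ
  g j = bit (circular N r j)
  N≡ : ∀ r c → suc (2 * r + c) ≡ 1 + (r + (c + r))
  N≡ = solve-∀
  near : ∀ {j} → 1 ≤ j → j < N → j ≤ r ⊎ N ≤ j + r → g j ≡ 1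
  near {j} 1≤j j<N close = cong bit (within-true (⊓-glb 1≤j (m<n⇒0<n∸m j<N)) (⊓≤r close))
    where
    ⊓≤r : j ≤ r ⊎ N ≤ j + r → j ⊓ (N ∸ j) ≤ r
    ⊓≤r (inj₁ j≤r)   = ≤-trans (m⊓n≤m j (N ∸ j)) j≤r
    ⊓≤r (inj₂ N≤j+r) = ≤-trans (m⊓n≤n j (N ∸ j)) (m≤n+o⇒m∸n≤o N j N≤j+r)
  low : ∀ i → g (1 + toℕ {r} i) ≡ 1
  low i = near (s≤s z≤n) (s≤s (≤-trans (toℕ<n i) (≤-trans (m≤m+n r (r + 0)) (m≤m+n (2 * r) c)))) (inj₁ (toℕ<n i))
  middle : ∀ i → g (1 + r + toℕ {c} i) ≡ 0
  middle i = cong bit (within-false (⊓-glb (s≤s (m≤m+n r (toℕ i))) (m+n≤o⇒m≤o∸n (suc r) (begin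
    suc r + (1 + r + toℕ i)   ≡⟨ regroup r (toℕ i) ⟩
    suc (2 * r) + suc (toℕ i) ≤⟨ +-monoʳ-≤ (suc (2 * r)) (toℕ<n i) ⟩
    suc (2 * r) + c           ∎))))
    where
    regroup : ∀ r i → suc r + (1 + r + i) ≡ suc (2 * r) + suc i
    regroup = solve-∀
  high : ∀ i → g (1 + r + c + toℕ {r} i) ≡ 1
  high i = near (s≤s z≤n)
    (begin-strict
      suc (r + c + toℕ i) <⟨ s≤s (+-monoʳ-< (r + c) (toℕ<n i)) ⟩
      suc (r + c + r)     ≡⟨ regroup r c ⟩
      N                   ∎)
    (inj₂ (begin
      N                           ≡⟨ sym (regroup r c) ⟩
      suc (r + c) + r             ≤⟨ +-monoˡ-≤ r (m≤m+n (suc (r + c)) (toℕ i)) ⟩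
      suc (r + c) + toℕ i + r     ∎))
    where
    regroup : ∀ r c → 1 + (r + c + r) ≡ 1 + (2 * r + c)
    regroup = solve-∀

circulant : ℕ → (N : ℕ) → Graph N
circulant r N = record
  { adj    = λ u v → circular N r ∣ toℕ u - toℕ v ∣
  ; sym    = λ u v → cong (circular N r) (∣-∣-comm (toℕ u) (toℕ v))
  ; irrefl = λ u → cong (circular N r) (∣n-n∣≡0 (toℕ u))
  }

∑-circulant : ∀ {N} r → 2 * r < N → ∀ i → i < N → ∑[ j < N ] bit (circular N r ∣ i - toℕ j ∣) ≡ 2 * r
∑-circulant {N} r 2r<N i i<N = trans
  (rotate (λ d → bit (circular N r d)) (λ d≤N → cong bit (circular-reflect r d≤N)) i i<N)
  (∑-circular r 2r<N)

circulant-regular : ∀ {N} r → 2 * r < N → Regular (2 * r) (circulant r N)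
circulant-regular {N} r 2r<N v = trans (degree-sum (circulant r N) v) (∑-circulant r 2r<N (toℕ v) (toℕ<n v))

-- The near-perfect matching {i, i + h}, i < h, of the vertices 0, …, 2h leaves out the vertex 2h.
matched : ℕ → ℕ → ℕ → Bool
matched h i j = (∣ i - j ∣ ≡ᵇ h) ∧ (i ⊔ j <ᵇ h + h)

Matched : ℕ → ℕ → ℕ → Set
Matched h i j = ∣ i - j ∣ ≡ h × i ⊔ j < h + h

matched? : ∀ h i j → Dec (Matched h i j)
matched? h i j = (∣ i - j ∣ ≟ h) ×-dec (i ⊔ j <? h + h)

matched-low : ∀ {h i} → i < h → ∀ j → matched h i j ≡ (i + h ≡ᵇ j)
matched-low {h} {i} i<h j = does-⇔ (mk⇔ mate mated) (matched? h i j) (i + h ≟ j)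
  where
  mate : Matched h i j → i + h ≡ j
  mate (d≡h , _) with ≤-total i j
  ... | inj₁ i≤j = trans (cong (i +_) (trans (sym d≡h) (m≤n⇒∣m-n∣≡n∸m i≤j))) (m+[n∸m]≡n i≤j)
  ... | inj₂ j≤i = ⊥-elim (<⇒≱ i<h (subst (_≤ i) (trans (sym (m≤n⇒∣n-m∣≡n∸m j≤i)) d≡h) (m∸n≤m i j)))
  mated : i + h ≡ j → Matched h i j
  mated refl = ∣m-m+n∣≡n i h , ⊔-pres-<m (≤-trans i<h (m≤m+n h h)) (+-monoˡ-< h i<h)

matched-high : ∀ {h i} → i < h → ∀ j → matched h (i + h) j ≡ (i ≡ᵇ j)
matched-high {h} {i} i<h j = does-⇔ (mk⇔ mate mated) (matched? h (i + h) j) (i ≟ j)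
  where
  mate : Matched h (i + h) j → i ≡ j
  mate (d≡h , max<2h) with ≤-total (i + h) j
  ... | inj₁ i+h≤j = ⊥-elim (<⇒≱ max<2h (begin
    h + h                   ≤⟨ +-monoˡ-≤ h (m≤n+m h i) ⟩
    i + h + h               ≡⟨ cong (i + h +_) (trans (sym d≡h) (m≤n⇒∣m-n∣≡n∸m i+h≤j)) ⟩
    i + h + (j ∸ (i + h))   ≡⟨ m+[n∸m]≡n i+h≤j ⟩
    j                       ≤⟨ m≤n⊔m (i + h) j ⟩
    (i + h) ⊔ j             ∎))
  ... | inj₂ j≤i+h = +-cancelʳ-≡ h i j (trans (sym (m+[n∸m]≡n j≤i+h))
    (cong (j +_) (trans (sym (m≤n⇒∣n-m∣≡n∸m j≤i+h)) d≡h)))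
  mated : i ≡ j → Matched h (i + h) j
  mated refl = trans (∣-∣-comm (i + h) i) (∣m-m+n∣≡n i h) , ⊔-pres-<m (+-monoˡ-< h i<h) (≤-trans i<h (m≤n+m h h))

-- Three ranges: i < h has the mate i + h, h ≤ i < 2h has the mate i - h, and the indicator makes up
-- for the unmatched vertex 2h.
∑-matched : ∀ {h} i → i < suc (h + h) → ∑[ j < suc (h + h) ] bit (matched h i (toℕ j)) + δ (h + h) i ≡ 1
∑-matched {h} i i<N with i <? h
... | yes i<h = cong₂ _+_
  (trans (sum-cong-≗ {suc (h + h)} (λ j → cong bit (matched-low i<h (toℕ j)))) (sum-δ (s≤s (+-monoˡ-≤ h (<⇒≤ i<h)))))
  (δ-≢ (>⇒≢ (≤-trans i<h (m≤n+m h h))))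
... | no i≮h with m≤n⇒∃[o]m+o≡n (≮⇒≥ i≮h)
...   | o , refl with o <? h
...     | yes o<h rewrite +-comm h o = cong₂ _+_
  (trans (sum-cong-≗ {suc (h + h)} (λ j → cong bit (matched-high o<h (toℕ j)))) (sum-δ (s≤s (≤-trans (<⇒≤ o<h) (m≤n+m h h)))))
  (δ-≢ (>⇒≢ (+-monoˡ-< h o<h)))
...     | no o≮h with ≤-antisym (+-cancelˡ-≤ h o h (≤-pred i<N)) (≮⇒≥ o≮h)
...       | refl = cong₂ _+_
  (sum-zero {suc (h + h)} (λ j → cong bit (dec-false (matched? h (h + h) (toℕ j))
    (λ (_ , max<2h) → <⇒≱ max<2h (m≤m⊔n (h + h) (toℕ j))))))
  (δ-refl (h + h))

-- Graphs of odd order with one vertex of smaller degree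

module _ {r h} (r<h : r < h) where

  private
    N : ℕ
    N = suc (h + h)
    adjacent : ℕ → ℕ → Bool
    adjacent i j = circular N r ∣ i - j ∣ ∨ matched h i j

  near-regular : Graph N
  near-regular = record
    { adj    = λ u v → adjacent (toℕ u) (toℕ v)
    ; sym    = λ u v → cong₂ (λ d x → circular N r d ∨ ((d ≡ᵇ h) ∧ (x <ᵇ h + h)))
                         (∣-∣-comm (toℕ u) (toℕ v)) (⊔-comm (toℕ u) (toℕ v))
    ; irrefl = λ u → loopless (toℕ u)
    }
    where
    loopless : ∀ i → adjacent i i ≡ false
    loopless i rewrite ∣n-n∣≡0 i | ≡ᵇ-false {0} {h} (<⇒≢ (≤-<-trans z≤n r<h)) = refl

  near-regular-deficient : ∀ v → degree near-regular v + δ (h + h) (toℕ v) ≡ suc (2 * r)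
  near-regular-deficient v = begin-equality
    degree near-regular v + δ (h + h) i
      ≡⟨ cong (_+ δ (h + h) i) (trans (degree-sum near-regular v)
           (trans (sum-cong-≗ {N} (λ j → disjoint (toℕ j)))
                  (∑-distrib-+ {N} (λ j → bit (circular N r ∣ i - toℕ j ∣)) (λ j → bit (matched h i (toℕ j)))))) ⟩
    ∑[ j < N ] bit (circular N r ∣ i - toℕ j ∣) + ∑[ j < N ] bit (matched h i (toℕ j)) + δ (h + h) i
      ≡⟨ +-assoc (∑[ j < N ] bit (circular N r ∣ i - toℕ j ∣)) _ _ ⟩
    ∑[ j < N ] bit (circular N r ∣ i - toℕ j ∣) + (∑[ j < N ] bit (matched h i (toℕ j)) + δ (h + h) i)
      ≡⟨ cong₂ _+_ (∑-circulant r 2r<N i (toℕ<n v)) (∑-matched {h} i (toℕ<n v)) ⟩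
    2 * r + 1
      ≡⟨ +-comm (2 * r) 1 ⟩
    suc (2 * r)
      ∎
    where
    i : ℕ
    i = toℕ v
    2r<N : 2 * r < N
    2r<N = s≤s (+-mono-≤ (<⇒≤ r<h) (≤-trans (≤-reflexive (+-identityʳ r)) (<⇒≤ r<h)))
    disjoint : ∀ j → bit (adjacent i j) ≡ bit (circular N r ∣ i - j ∣) + bit (matched h i j)
    disjoint j with ∣ i - j ∣ ≟ h
    -- Matched vertices have cyclic distance h ⊓ (h + 1) = h > r, so no matching edge is already in
    -- the circulant.
    ... | yes d≡h rewrite d≡h | m+n∸n≡m (suc h) h
                | within-false {r} (⊓-glb r<h (≤-trans r<h (n≤1+n h))) = refl
    ... | no  d≢h rewrite ≡ᵇ-false d≢h | Bool.∨-identityʳ (circular N r ∣ i - j ∣) = sym (+-identityʳ _)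

-- Assembling the regular graph

∑-∧ˡ : ∀ {n} c {d} → d < n → ∑[ j < n ] bit (c ∧ (d ≡ᵇ toℕ j)) ≡ bit c
∑-∧ˡ     true  d<n = sum-δ d<n
∑-∧ˡ {n} false d<n = sum-zero {n} (λ _ → refl)

∑-∧ʳ : ∀ {n} c {d} → d < n → ∑[ j < n ] bit ((d ≡ᵇ toℕ j) ∧ c) ≡ bit c
∑-∧ʳ {n} c d<n = trans (sum-cong-≗ {n} (λ j → cong bit (Bool.∧-comm _ c))) (∑-∧ˡ c d<n)

2∤odd : ∀ x → ¬ 2 ∣ suc (2 * x)
2∤odd x 2∣ with ∣1⇒≡1 (∣m+n∣m⇒∣n (subst (2 ∣_) (+-comm 1 (2 * x)) 2∣) (m∣m*n x))
... | ()

B∪circulant : ∀ {k} r N → k ≡ 2 * r → isEven k ≡ true → k < N →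
  Σ (Graph (bSize k + N)) λ G → Regular k G × SubgraphOf (B k) G
B∪circulant {k} r N refl k-even k<N = bridged (B k) (circulant r N) none , bridged-regular (B k) (circulant r N) none
  (λ a → trans (cong₂ _+_ (B-regular k-even a) (sum-zero {N} (λ _ → refl))) (+-identityʳ k))
  (λ b → cong₂ _+_ (sum-zero {bSize k} (λ _ → refl)) (circulant-regular r k<N b)) ,
  ⊆bridged (B k) (circulant r N) none
  where
  none : Fin (bSize k) → Fin N → Bool
  none _ _ = false

-- Vertex 1 of `B k` and vertex 2h of the other part are the only ones of degree k - 1; the single
-- bridge joins them.
B∪near-regular : ∀ {k} r h → k ≡ suc (2 * r) → isEven k ≡ false → r < h →
  Σ (Graph (bSize k + suc (h + h))) λ G → Regular k G × SubgraphOf (B k) G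
B∪near-regular {k} r h refl k-odd r<h = bridged (B k) G′ bridge , bridged-regular (B k) G′ bridge
  (λ a → trans (cong (degree (B k) a +_) (∑-∧ˡ (1 ≡ᵇ toℕ a) (n<1+n (h + h)))) (B-deficient k-odd a))
  (λ b → trans (cong (_+ degree G′ b) (∑-∧ʳ (h + h ≡ᵇ toℕ b) 1<bSize))
               (trans (+-comm (δ (h + h) (toℕ b)) _) (near-regular-deficient r<h b))) ,
  ⊆bridged (B k) G′ bridge
  where
  G′ : Graph (suc (h + h))
  G′ = near-regular r<h
  bridge : Fin (bSize k) → Fin (suc (h + h)) → Bool
  bridge a b = (1 ≡ᵇ toℕ a) ∧ (h + h ≡ᵇ toℕ b)
  1<bSize : 1 < bSize k
  1<bSize = subst (1 <_) (sym (bSize-odd k-odd)) (s≤s (s≤s z≤n))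

regular-⊇B-even : ∀ {k n} → isEven k ≡ true → 3 * k + 5 ≤ n →
  Σ (Graph n) λ G → Regular k G × SubgraphOf (B k) G
regular-⊇B-even {k} {n} k-even 3k+5≤n with even⇒2* k k-even | m≤n⇒∃[o]m+o≡n bSize≤n
  where
  slack : ∀ k → suc k + (2 * k + 4) ≡ 3 * k + 5
  slack = solve-∀
  bSize≤n : bSize k ≤ n
  bSize≤n = begin
    bSize k             ≡⟨ bSize-even k-even ⟩
    suc k               ≤⟨ m≤m+n (suc k) (2 * k + 4) ⟩
    suc k + (2 * k + 4) ≡⟨ slack k ⟩
    3 * k + 5           ≤⟨ 3k+5≤n ⟩
    n                   ∎
... | r , k≡2r | N , refl = B∪circulant r N k≡2r k-even (+-cancelˡ-≤ (suc k) (suc k) N (begin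
    suc k + suc k           ≤⟨ m≤m+n _ (k + 3) ⟩
    suc k + suc k + (k + 3) ≡⟨ slack k ⟩
    3 * k + 5               ≤⟨ 3k+5≤n ⟩
    bSize k + N             ≡⟨ cong (_+ N) (bSize-even k-even) ⟩
    suc k + N               ∎))
  where
  slack : ∀ k → suc k + suc k + (k + 3) ≡ 3 * k + 5
  slack = solve-∀

module _ {k u} (k-odd : isEven k ≡ false) (k≡1+2u : k ≡ suc (2 * u)) where

  -- For even N the factors k + 2 + N and k would both be odd, and so would their product.
  complement-odd : ∀ N → 2 ∣ (bSize k + N) * k → isEven N ≡ false
  complement-odd N 2∣ = Bool.¬-not λ N-even → absurd (even⇒2* N N-even)
    where
    expand : ∀ u h → (suc (suc (suc (2 * u))) + 2 * h) * suc (2 * u) ≡ suc (2 * (1 + 4 * u + h + 2 * u * u + 2 * u * h))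
    expand = solve-∀
    absurd : ¬ (∃ λ h → N ≡ 2 * h)
    absurd (h , refl) = 2∤odd (1 + 4 * u + h + 2 * u * u + 2 * u * h) (subst (2 ∣_) (begin-equality
      (bSize k + 2 * h) * k                             ≡⟨ cong (λ p → (p + 2 * h) * k) (bSize-odd {k} k-odd) ⟩
      (suc (suc k) + 2 * h) * k                         ≡⟨ cong (λ k → (suc (suc k) + 2 * h) * k) k≡1+2u ⟩
      (suc (suc (suc (2 * u))) + 2 * h) * suc (2 * u)   ≡⟨ expand u h ⟩
      suc (2 * (1 + 4 * u + h + 2 * u * u + 2 * u * h)) ∎) 2∣)

  -- Otherwise n ≤ (k + 2) + k, which is below 3k + 5.
  u<half-complement : ∀ {h} → 3 * k + 5 ≤ bSize k + suc (2 * h) → u < h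
  u<half-complement {h} 3k+5≤n = ≰⇒> λ h≤u → <-irrefl refl (begin-strict
    bSize k + suc (2 * h)         ≡⟨ cong (_+ suc (2 * h)) (bSize-odd {k} k-odd) ⟩
    suc (suc k) + suc (2 * h)     ≤⟨ +-monoʳ-≤ (suc (suc k)) (s≤s (*-monoʳ-≤ 2 h≤u)) ⟩
    suc (suc k) + suc (2 * u)     ≡⟨ cong (suc (suc k) +_) (sym k≡1+2u) ⟩
    suc (suc k) + k               <⟨ +-monoʳ-< (suc (suc k)) (n<1+n k) ⟩
    suc (suc k) + suc k           ≤⟨ m≤m+n _ (k + 2) ⟩
    suc (suc k) + suc k + (k + 2) ≡⟨ slack k ⟩
    3 * k + 5                     ≤⟨ 3k+5≤n ⟩
    bSize k + suc (2 * h)         ∎)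
    where
    slack : ∀ k → suc (suc k) + suc k + (k + 2) ≡ 3 * k + 5
    slack = solve-∀

regular-⊇B-odd : ∀ {k n} → isEven k ≡ false → 3 * k + 5 ≤ n → 2 ∣ n * k →
  Σ (Graph n) λ G → Regular k G × SubgraphOf (B k) G
regular-⊇B-odd {k} {n} k-odd 3k+5≤n 2∣nk with odd⇒1+2* k k-odd | m≤n⇒∃[o]m+o≡n bSize≤n
  where
  slack : ∀ k → suc (suc k) + (2 * k + 3) ≡ 3 * k + 5
  slack = solve-∀
  bSize≤n : bSize k ≤ n
  bSize≤n = begin
    bSize k                   ≡⟨ bSize-odd k-odd ⟩
    suc (suc k)               ≤⟨ m≤m+n (suc (suc k)) (2 * k + 3) ⟩
    suc (suc k) + (2 * k + 3) ≡⟨ slack k ⟩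
    3 * k + 5                 ≤⟨ 3k+5≤n ⟩
    n                         ∎
... | u , k≡1+2u | N , refl with odd⇒1+2* N (complement-odd {k} {u} k-odd k≡1+2u N 2∣nk)
-- `2 * h` unfolds to `h + (h + 0)`, while the construction has `h + h`.
...   | h , refl = subst (λ x → Σ (Graph (bSize k + suc (h + x))) λ G → Regular k G × SubgraphOf (B k) G)
  (sym (+-identityʳ h))
  (B∪near-regular u h k≡1+2u k-odd (u<half-complement {k} {u} k-odd k≡1+2u 3k+5≤n))

theorem4p4 : (k : ℕ) → 2 ≤ k →
    ((n : ℕ) (H : Graph n) → SubgraphOf (B k) H → CmsAtMostFrac H (k + 1))
    × ((n : ℕ) → 3 * k + 5 ≤ n → 2 ∣ n * k →
    Σ (Graph n) λ G → Regular k G × SubgraphOf (B k) G)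
theorem4p4 k 2≤k with isEven k Bool.≟ true
... | yes k-even = cms-bound (even⇒2* k k-even) , (λ _ 3k+5≤n _ → regular-⊇B-even k-even 3k+5≤n)
  where
  cms-bound : (∃ λ t → k ≡ 2 * t) → ∀ n (H : Graph n) → SubgraphOf (B k) H → CmsAtMostFrac H (k + 1)
  cms-bound (zero  , refl) = contradiction 2≤k λ ()
  cms-bound (suc t , refl) n H = cms-bound-regular {P = B k} {H} (suc t) (bSize-even {k} k-even) (s≤s z≤n) (B-regular {k} k-even)
... | no ¬k-even = cms-bound (odd⇒1+2* k k-odd) , (λ _ → regular-⊇B-odd k-odd)
  where
  k-odd : isEven k ≡ false
  k-odd = Bool.¬-not ¬k-even
  1<bSize : 1 < bSize k
  1<bSize = subst (1 <_) (sym (bSize-odd k-odd)) (s≤s (s≤s z≤n))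
  middle : Fin (bSize k)
  middle = fromℕ< 1<bSize
  degree≡ : ∀ v → degree (B k) v + δ (toℕ middle) (toℕ v) ≡ k
  degree≡ v = trans (cong (λ w → degree (B k) v + δ w (toℕ v)) (toℕ-fromℕ< 1<bSize)) (B-deficient {k} k-odd v)
  cms-bound : (∃ λ u → k ≡ suc (2 * u)) → ∀ n (H : Graph n) → SubgraphOf (B k) H → CmsAtMostFrac H (k + 1)
  -- This would be k = 1; the deficient bound requires `1 ≤ u`.
  cms-bound (zero  , refl) = contradiction 2≤k λ { (s≤s ()) }
  cms-bound (suc u , refl) n H = cms-bound-deficient {P = B k} {H} (suc u)
    (trans (bSize-odd {k} k-odd) (cong suc (sym (*-suc 2 (suc u))))) (s≤s z≤n) middle degree≡
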